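{- Let $M$ be a matroid of rank $r$ on $\{1,2,\ldots,n\}$. Then its Tutte polynomial $T(M;x,y)$ can be written as a linear combination with non-negative integer coefficients of the polynomials $\bar\gamma(\underline{a};x,y)$, where $\underline{a}$ ranges over $(n,r)$-compositions. One way to do this is $$T(M;x,y)=\sum_{\underline{a}}\nu(M;\underline{a})\,\bar\gamma(\underline{a};x,y),$$ where the sum ranges over all $(n,r)$-compositions $\underline{a}$.
   Context: The Tutte polynomial of a rank-$r$ matroid on $S$ is $T(M;x,y)=\sum_{A\subseteq S}(x-1)^{r-\mathrm{rk}(A)}(y-1)^{|A|-\mathrm{rk}(A)}$. An $(n,r)$-composition is an integer sequence $\underline{a}=a_0,a_1,\ldots,a_r$ with $a_0\ge 0$, $a_i\ge 1$ for $1\le i\le r$, and $a_0+\cdots+a_r=n$. It is identified with the bit sequence $0^{a_0}10^{a_1-1}10^{a_2-1}\cdots 10^{a_r-1}$ of length $n$ with exactly $r$ ones (an $(n,r)$-sequence). For $(n,r)$-sequences, $\underline{b}\trianglerighteq\underline{a}$ means that for every $j$ the initial segment of length $j$ of $\underline{b}$ contains at least as many $1$'s as that of $\underline{a}$. $\mathcal{G}(n,r)$ is the vector space, over a field of characteristic zero, with basis the formal symbols $[\underline{b}]$, one for each $(n,r)$-sequence $\underline{b}$. The linear map $\mathsf{Sp}$ from $\mathcal{G}(n,r)$ to polynomials in $x,y$ is given by $$[r_1\cdots r_n]\mapsto\frac1{n!}\sum_{m=0}^n\binom nm (x-1)^{r-w_m}(y-1)^{m-w_m},\qquad w_m=r_1+\cdots+r_m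 .$$ For an $(n,r)$-composition $\underline{a}$, with $(t)_k=t(t-1)\cdots(t-k+1)$, $$\gamma(\underline{a})=\sum_{\underline{b}\trianglerighteq\underline{a}}(a_0)_{b_0}\prod_{j=1}^r a_j\Big(a_j-1+\sum_{i=0}^{j-1}(a_i-b_i)\Big)_{b_j-1}[0^{b_0}10^{b_1-1}\cdots10^{b_r-1}],$$ the sum being over $(n,r)$-compositions $\underline{b}$ whose bit sequences satisfy $\underline{b}\trianglerighteq\underline{a}$. Set $\bar\gamma(\underline{a};x,y)=\mathsf{Sp}(\gamma(\underline{a}))$. $\nu(M;a_0,\ldots,a_r)$ is the number of flags (maximal chains of flats) $X_0\subset X_1\subset\cdots\subset X_r$ of $M$ with $\mathrm{rk}(X_i)=i$, $|X_0|=a_0$, and $|X_i|-|X_{i-1}|=a_i$ for $1\le i\le r$. -}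

module Defs where

open import Level using (Level)
open import Algebra.Bundles using (RawMonoid; RawRing; CommutativeRing)
open import Algebra.Apartness.Bundles using (HeytingField; HeytingCommutativeRing)
import Algebra.Definitions.RawSemiring as RawSemiringDefs
open import Data.Fin as Fin using (Fin; toℕ; inject₁)
open import Data.Fin.Properties using (all?)
open import Data.Fin.Subset using (Subset; inside; outside; _∉_; _⊆_; _⊂_; _∪_; _∩_; ∣_∣; ⁅_⁆; ⊤)
open import Data.Fin.Subset.Properties using (_∈?_; _⊂?_)
open import Data.Integer as ℤ using (ℤ; -[1+_])
open import Data.List as List using (List; []; _∷_; _++_; allFin; filter; foldr; length; upTo; cartesianProductWith)
open import Data.Nat as ℕ using (ℕ; zero; suc; _+_; _∸_; _≤_; _<_; z≤n; s≤s; NonZero; _!)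
open import Data.Nat.Combinatorics using (_C_)
open import Data.Nat.Properties as ℕₚ using (_!≢0)
open import Data.Product using (_×_; _,_; proj₁)
open import Data.Vec as Vec using (Vec; []; _∷_; lookup)
open import Data.Vec.Relation.Unary.All as All using (All; []; _∷_)
open import Relation.Binary.PropositionalEquality using (_≡_; refl; cong; module ≡-Reasoning)
open import Relation.Nullary using (Dec; yes; no; does)
open import Relation.Nullary.Decidable using (_×-dec_; ¬?; _→-dec_; map′)
open import Data.Bool using (if_then_else_)

private
  variable
    a c ℓ ℓ₁ ℓ₂ : Level
    A : Set a
    n r : ℕ

module _ (M : RawMonoid c ℓ) where
  open RawMonoid M

  fold : List A → (A → Carrier) → Carrier
  fold xs f = foldr _∙_ ε (List.map f xs)

record Matroid (n : ℕ) : Set where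
  field
    rk         : Subset n → ℕ
    rk-bounded : ∀ p → rk p ≤ ∣ p ∣
    rk-mono    : ∀ {p q} → p ⊆ q → rk p ≤ rk q
    rk-submod  : ∀ p q → rk (p ∪ q) + rk (p ∩ q) ≤ rk p + rk q

  rank : ℕ
  rank = rk ⊤

  IsFlat : Subset n → Set
  IsFlat p = ∀ e → e ∉ p → rk p < rk (p ∪ ⁅ e ⁆)

  isFlat? : ∀ p → Dec (IsFlat p)
  isFlat? p = all? λ e → ¬? (e ∈? p) →-dec (rk p ℕ.<? rk (p ∪ ⁅ e ⁆))

open Matroid using (rk; rank; IsFlat; isFlat?)

vectors : List A → ∀ k → List (Vec A k)
vectors xs zero    = [] ∷ []
vectors xs (suc k) = cartesianProductWith _∷_ xs (vectors xs k)

subsets : ∀ n → List (Subset n)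
subsets = vectors (outside ∷ inside ∷ [])

-- Bit sequences of length n with exactly r ones.
infixr 5 0∷_ 1∷_
data Sequence : ℕ → ℕ → Set where
  []  : Sequence 0 0
  0∷_ : Sequence n r → Sequence (suc n) r
  1∷_ : Sequence n r → Sequence (suc n) (suc r)

infix 4 _≟_
_≟_ : (s t : Sequence n r) → Dec (s ≡ t)
[]     ≟ []     = yes refl
(0∷ s) ≟ (0∷ t) = map′ (cong 0∷_) (λ { refl → refl }) (s ≟ t)
(0∷ s) ≟ (1∷ t) = no λ ()
(1∷ s) ≟ (0∷ t) = no λ ()
(1∷ s) ≟ (1∷ t) = map′ (cong 1∷_) (λ { refl → refl }) (s ≟ t)

-- Each (n,r)-sequence occurs exactly once.
sequences : ∀ n r → List (Sequence n r)
sequences zero    zero    = [] ∷ []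
sequences zero    (suc r) = []
sequences (suc n) zero    = List.map 0∷_ (sequences n zero)
sequences (suc n) (suc r) =
  List.map 0∷_ (sequences n (suc r)) ++ List.map 1∷_ (sequences n r)

-- Number of ones among the first m bits.
ones : ℕ → Sequence n r → ℕ
ones zero    s      = 0
ones (suc m) []     = 0
ones (suc m) (0∷ s) = ones m s
ones (suc m) (1∷ s) = suc (ones m s)

infix 4 _⊵_ _⊵?_
_⊵_ : Sequence n r → Sequence n r → Set
_⊵_ {n} t s = (j : Fin (suc n)) → ones (toℕ j) s ≤ ones (toℕ j) t

_⊵?_ : (t s : Sequence n r) → Dec (t ⊵ s)
t ⊵? s = all? λ j → ones (toℕ j) s ℕ.≤? ones (toℕ j) t

record Composition (n r : ℕ) : Set where
  constructor composition
  field
    first    : ℕ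
    rest     : Vec ℕ r
    positive : All (1 ≤_) rest
    total    : first + Vec.sum rest ≡ n

  part : Fin (suc r) → ℕ
  part = lookup (first ∷ rest)

open Composition using (part)

zeros : ∀ k → Sequence n r → Sequence (k + n) r
zeros zero    s = s
zeros (suc k) s = 0∷ zeros k s

blocks : (as : Vec ℕ r) → All (1 ≤_) as → Sequence (Vec.sum as) r
blocks []           []       = []
blocks (suc k ∷ as) (_ ∷ ps) = 1∷ zeros k (blocks as ps)

-- 0^a₀ 1 0^(a₁-1) ⋯ 1 0^(aᵣ-1)
toSequence : Composition n r → Sequence n r
toSequence (composition a₀ as pos refl) = zeros a₀ (blocks as pos)

fromSequence : Sequence n r → Composition n r
fromSequence []     = composition 0 [] [] refl
fromSequence (0∷ s) with fromSequence s
... | composition a₀ as pos tot = composition (suc a₀) as pos (cong suc tot)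
fromSequence (1∷ s) with fromSequence s
... | composition a₀ as pos tot =
  composition 0 (suc a₀ ∷ as) (s≤s z≤n ∷ pos) (cong suc tot)

toSequence-fromSequence : (s : Sequence n r) → toSequence (fromSequence s) ≡ s
toSequence-fromSequence []     = refl
toSequence-fromSequence (0∷ s) with fromSequence s | toSequence-fromSequence s
... | composition _ _ _ refl | eq = cong 0∷_ eq
toSequence-fromSequence (1∷ s) with fromSequence s | toSequence-fromSequence s
... | composition _ _ _ refl | eq = cong 1∷_ eq

private
  composition-≡ : ∀ {a b} {as bs : Vec ℕ r} {p q t u} → a ≡ b → as ≡ bs →
                  composition {n} a as p t ≡ composition b bs q u
  composition-≡ {p = p} {q} {t} {u} refl refl
    rewrite All.irrelevant ℕₚ.≤-irrelevant p q | ℕₚ.≡-irrelevant t u = refl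

  fromSequence-zeros : ∀ k (s : Sequence n r) →
    Composition.first (fromSequence (zeros k s)) ≡ k + Composition.first (fromSequence s)
    × Composition.rest (fromSequence (zeros k s)) ≡ Composition.rest (fromSequence s)
  fromSequence-zeros zero    s = refl , refl
  fromSequence-zeros (suc k) s with fromSequence-zeros k s
  ... | eq₁ , eq₂ = cong suc eq₁ , eq₂

  fromSequence-blocks : (as : Vec ℕ r) (ps : All (1 ≤_) as) →
    Composition.first (fromSequence (blocks as ps)) ≡ 0
    × Composition.rest (fromSequence (blocks as ps)) ≡ as
  fromSequence-blocks []           []       = refl , refl
  fromSequence-blocks (suc k ∷ as) (_ ∷ ps)
    with fromSequence-zeros k (blocks as ps) | fromSequence-blocks as ps
  ... | eq₁ , eq₂ | eq₃ , eq₄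
    rewrite eq₁ | eq₂ | eq₃ | eq₄ | ℕₚ.+-identityʳ k = refl , refl

fromSequence-toSequence : (a : Composition n r) → fromSequence (toSequence a) ≡ a
fromSequence-toSequence (composition a₀ as pos refl)
  with fromSequence-zeros a₀ (blocks as pos) | fromSequence-blocks as pos
... | eq₁ , eq₂ | eq₃ , eq₄ = composition-≡ (begin
    _      ≡⟨ eq₁ ⟩
    a₀ + _ ≡⟨ cong (a₀ +_) eq₃ ⟩
    a₀ + 0 ≡⟨ ℕₚ.+-identityʳ a₀ ⟩
    a₀     ∎) (begin
    _      ≡⟨ eq₂ ⟩
    _      ≡⟨ eq₄ ⟩
    as     ∎)
  where open ≡-Reasoning

-- Each (n,r)-composition occurs exactly once, since fromSequence is a bijection.
compositions : ∀ n r → List (Composition n r)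
compositions n r = List.map fromSequence (sequences n r)

module _ (M : Matroid n) (a : Composition n r) where

  IsFlag : Vec (Subset n) (suc r) → Set
  IsFlag X =
      (∀ i → IsFlat M (lookup X i) × rk M (lookup X i) ≡ toℕ i)
    × (∀ (i : Fin r) → lookup X (inject₁ i) ⊂ lookup X (Fin.suc i))
    × ∣ lookup X Fin.zero ∣ ≡ part a Fin.zero
    × (∀ (i : Fin r) →
         ∣ lookup X (Fin.suc i) ∣ ∸ ∣ lookup X (inject₁ i) ∣ ≡ part a (Fin.suc i))

  isFlag? : ∀ X → Dec (IsFlag X)
  isFlag? X =
            all? (λ i → isFlat? M (lookup X i) ×-dec (rk M (lookup X i) ℕ.≟ toℕ i))
    ×-dec all? (λ i → lookup X (inject₁ i) ⊂? lookup X (Fin.suc i))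
    ×-dec (∣ lookup X Fin.zero ∣ ℕ.≟ part a Fin.zero)
    ×-dec all? (λ i →
            (∣ lookup X (Fin.suc i) ∣ ∸ ∣ lookup X (inject₁ i) ∣) ℕ.≟ part a (Fin.suc i))

  ν : ℕ
  ν = length (filter isFlag? (vectors (subsets n) (suc r)))

-- The falling factorial (t)ₖ.
infixl 8 _↓_
_↓_ : ℤ → ℕ → ℤ
t ↓ zero  = ℤ.1ℤ
t ↓ suc k = t ℤ.* (t ℤ.- ℤ.1ℤ) ↓ k

-- j : Fin r stands for the index j + 1 ∈ {1, …, r}.
γ-coefficient : Composition n r → Composition n r → ℤ
γ-coefficient {r = r} a b =
  (ℤ.+ part a Fin.zero) ↓ part b Fin.zero ℤ.*
  fold ℤ.*-1-rawMonoid (allFin r) λ j →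
    ℤ.+ part a (Fin.suc j) ℤ.*
    (ℤ.+ part a (Fin.suc j) ℤ.- ℤ.1ℤ ℤ.+ excess (Fin.suc j)) ↓ (part b (Fin.suc j) ∸ 1)
  where
  excess : Fin (suc r) → ℤ
  excess j = fold ℤ.+-0-rawMonoid (filter (Fin._<? j) (allFin (suc r))) λ i →
    ℤ.+ part a i ℤ.- ℤ.+ part b i

-- Polynomials in one variable as coefficient lists, lowest degree first;
-- trailing zeros are allowed, so equality is equality of all coefficients.

module _ (R : RawRing c ℓ) where
  private module R = RawRing R

  coefficient : List R.Carrier → ℕ → R.Carrier
  coefficient []      i       = R.0#
  coefficient (k ∷ p) zero    = k
  coefficient (k ∷ p) (suc i) = coefficient p i

  private
    add : List R.Carrier → List R.Carrier → List R.Carrier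
    add []      q       = q
    add (k ∷ p) []      = k ∷ p
    add (k ∷ p) (l ∷ q) = (k R.+ l) ∷ add p q

    mul : List R.Carrier → List R.Carrier → List R.Carrier
    mul []      q = []
    mul (k ∷ p) q = add (List.map (k R.*_) q) (R.0# ∷ mul p q)

  polynomialRawRing : RawRing c ℓ
  polynomialRawRing = record
    { Carrier = List R.Carrier
    ; _≈_     = λ p q → ∀ i → coefficient p i R.≈ coefficient q i
    ; _+_     = add
    ; _*_     = mul
    ; -_      = List.map R.-_
    ; 0#      = []
    ; 1#      = R.1# ∷ []
    }

private
  raw : HeytingField c ℓ₁ ℓ₂ → RawRing c ℓ₁
  raw K = CommutativeRing.rawRing (HeytingCommutativeRing.commutativeRing
    (HeytingField.heytingCommutativeRing K))

-- A Heyting field is the constructive notion of field, with _#_ in place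
-- of inequality; classically every field is one, with x # y = ¬ (x ≈ y).
CharacteristicZero : HeytingField c ℓ₁ ℓ₂ → Set ℓ₂
CharacteristicZero K = ∀ k → .{{NonZero k}} → (k ×K 1#) # 0#
  where
  open HeytingField K
  open RawSemiringDefs (RawRing.rawSemiring (raw K)) using () renaming (_×_ to _×K_)

module Over (K : HeytingField c ℓ₁ ℓ₂) (char0 : CharacteristicZero K) where
  private
    module K = HeytingField K
    open RawSemiringDefs (RawRing.rawSemiring (raw K)) using () renaming (_×_ to _×K_)

  fromℤ : ℤ → K.Carrier
  fromℤ (ℤ.+ k)  = k ×K K.1#
  fromℤ -[1+ k ] = K.- (suc k ×K K.1#)

  -- #⇒invertible inverts the difference n! - 0.
  1/_! : ℕ → K.Carrier
  1/ n ! = proj₁ (K.#⇒invertible (char0 (n !) {{n !≢0}}))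

  -- K[x,y] = K[x][y]
  K[x] K[x,y] : RawRing c ℓ₁
  K[x]   = polynomialRawRing (raw K)
  K[x,y] = polynomialRawRing K[x]

  open RawRing K[x,y] public
    using () renaming (Carrier to Polynomial; _≈_ to infix 4 _≈_)
  private module P = RawRing K[x,y]
  open RawSemiringDefs (RawRing.rawSemiring K[x,y]) public
    using () renaming (_×_ to infixr 8 _×ₚ_; _^_ to infixr 8 _^_)

  x y : Polynomial
  x = (K.0# ∷ K.1# ∷ []) ∷ []
  y = [] ∷ (K.1# ∷ []) ∷ []

  infixr 8 _•_
  _•_ : K.Carrier → Polynomial → Polynomial
  k • p = List.map (List.map (k K.*_)) p

  ∑ : List A → (A → Polynomial) → Polynomial
  ∑ = fold P.+-rawMonoid

  -- (x - 1)^i (y - 1)^j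
  monomial : ℕ → ℕ → Polynomial
  monomial i j = (x P.+ P.- P.1#) ^ i P.* (y P.+ P.- P.1#) ^ j

  tutte : Matroid n → Polynomial
  tutte {n} M = ∑ (subsets n) λ p →
    monomial (rank M ∸ rk M p) (∣ p ∣ ∸ rk M p)

  -- A vector is given by its coordinates in the basis of (n,r)-sequences.
  𝒢 : ℕ → ℕ → Set c
  𝒢 n r = Sequence n r → K.Carrier

  𝒢-+-rawMonoid : ℕ → ℕ → RawMonoid c ℓ₁
  𝒢-+-rawMonoid n r = record
    { Carrier = 𝒢 n r
    ; _≈_     = λ g h → ∀ s → g s K.≈ h s
    ; _∙_     = λ g h s → g s K.+ h s
    ; ε       = λ _ → K.0#
    }

  infixr 8 _•ᴳ_
  _•ᴳ_ : K.Carrier → 𝒢 n r → 𝒢 n r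
  (k •ᴳ g) s = k K.* g s

  [_] : Sequence n r → 𝒢 n r
  [ s ] t = if does (s ≟ t) then K.1# else K.0#

  Sp-basis : Sequence n r → Polynomial
  Sp-basis {n} {r} s = 1/ n ! • ∑ (upTo (suc n)) λ m →
    (n C m) ×ₚ monomial (r ∸ ones m s) (m ∸ ones m s)

  -- The linear extension of Sp-basis.
  Sp : 𝒢 n r → Polynomial
  Sp {n} {r} g = ∑ (sequences n r) λ s → g s • Sp-basis s

  γ : Composition n r → 𝒢 n r
  γ {n} {r} a = fold (𝒢-+-rawMonoid n r)
    (filter (λ b → toSequence b ⊵? toSequence a) (compositions n r))
    λ b → fromℤ (γ-coefficient a b) •ᴳ [ toSequence b ]

  γ̄ : Composition n r → Polynomial
  γ̄ a = Sp (γ a)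

{-# OPTIONS --safe #-}

-- Order the ground set of M one element at a time and record the rank
-- increments as a bit sequence. The closures of the initial segments of an
-- ordering form a flag, and for a fixed flag with composition a the orderings
-- with bit sequence b are counted by choosing elements one by one: each choice
-- has as many options as the current flat has unplaced elements (bit 0) or as
-- the next step of the flag has elements (bit 1). This count is the coefficient
-- of [b] in γ(a), so Σ ν(M;a) γ(a) has as its coordinate at b the number of
-- orderings with bit sequence b. Applying Sp, each subset of size m is the
-- initial segment of m!(n-m)! orderings, a factor which cancels against
-- (n choose m)/n!, and what is left is the Tutte polynomial.

module Submission where

open import Defs
open import Level using (Level)
open import Algebra.Apartness.Bundles using (HeytingField; HeytingCommutativeRing)
open import Algebra.Bundles using (RawMonoid; RawRing; CommutativeRing; CommutativeSemiring)
open import Data.Bool as Bool using (true; false; if_then_else_)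
open import Data.Fin as Fin using (Fin; toℕ; inject₁)
import Data.Fin.Properties as Finₚ
open import Data.Fin.Subset using (Subset; inside; outside; _∈_; _∉_; _⊆_; _⊂_; _∪_; _∩_; ∣_∣; ⁅_⁆; ⊤; ⊥)
open import Data.Fin.Subset.Properties
open import Data.Integer as ℤ using (ℤ)
import Data.Integer.Properties as ℤₚ
open import Data.Integer.Solver using (module +-*-Solver)
open import Data.List as List using (List; []; _∷_; _++_; allFin; cartesianProductWith; filter; foldr; length; upTo)
open import Data.List.Membership.Propositional using () renaming (_∈_ to _∈ˡ_)
open import Data.List.Membership.Propositional.Properties
  using (∈-allFin; ∈-cartesianProductWith⁺; ∈-filter⁺; ∈-map⁺; ∈-map⁻; ∈-upTo⁺; ∈-upTo⁻; ∈-++⁺ˡ; ∈-++⁺ʳ)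
open import Data.List.Properties using (map-∘; map-cong; map-tabulate)
open import Data.List.Relation.Unary.All as AllL using ()
open import Data.List.Relation.Unary.All.Properties using (all-filter)
import Data.List.Relation.Unary.AllPairs as AllPairs
open import Data.List.Relation.Unary.Any using (here; there)
open import Data.List.Relation.Unary.Unique.Propositional using (Unique)
import Data.List.Relation.Unary.Unique.Propositional.Properties as Uniqueₚ
open import Data.Nat as ℕ using (ℕ; zero; suc; pred; _∸_; _≤_; _!; z≤n; s≤s)
open import Data.Nat.Combinatorics using (_C_; nCk≡n!/k![n-k]!; k![n∸k]!∣n!)
open import Data.Nat.DivMod using (m/n*n≡m)
import Data.Nat.Properties as ℕₚ
open import Data.Product using (_×_; _,_; proj₁; proj₂; Σ-syntax)
open import Data.Sum using (_⊎_; inj₁; inj₂; [_,_])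
open import Data.Unit using (tt) renaming (⊤ to Unit)
open import Data.Vec as Vec using (Vec; []; _∷_; lookup)
open import Data.Vec.Properties using (≡-dec; ∷-injective; lookup∘tabulate; []=⇒lookup; lookup⇒[]=)
open import Data.Vec.Relation.Binary.Pointwise.Extensional using (ext; Pointwise-≡⇒≡)
open import Data.Vec.Relation.Unary.All as All using (All; []; _∷_)
open import Function using (_∘_)
open import Relation.Binary.PropositionalEquality as ≡ using (_≡_; module ≡-Reasoning)
open import Relation.Nullary using (Dec; yes; no; does; ¬_; contradiction)
open import Relation.Nullary.Decidable using (_×-dec_; ¬?; dec-true)
open import Relation.Unary using (Pred; Decidable)

-- The count is set up for a set `p` already placed rather than for the empty set, since only then
-- does induction on the bits go through. Bit 0 keeps the closure of `p`. Bit 1 needs a double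
-- count: choosing an element and taking the closure is exchanged for choosing the next flat and
-- then one of its new elements. The sum defining γ(a) runs over b ⊵ a only, whereas orderings can
-- be counted for every b. The two are matched by reading ⊵ as a supply condition: a prefix of b of
-- length j with w ones asks for j elements, and the flat X_w provides a_0 + ... + a_w. If some
-- prefix overdraws, the count contains a factor 0. Bijections are expressed by 0-1 indicators in
-- sums over repetition-free enumerations, so that each becomes an exchange or a collapse of finite
-- sums. Polynomials are compared coefficient by coefficient; taking a coefficient is linear, so the
-- monomials stay unexpanded throughout.

private
  variable
    a b p q t : Level
    A : Set a
    B : Set b
    P : Set p
    Q : Set q
    T : Set t
    n k l r : ℕ

-- Folds, and finite sums with 0-1 indicators

fold-map : ∀ {c ℓ a b} (M : RawMonoid c ℓ) {A : Set a} {B : Set b} (h : A → B) (xs : List A)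
  (f : B → RawMonoid.Carrier M) → fold M (List.map h xs) f ≡ fold M xs (f ∘ h)
fold-map M h xs f = ≡.cong (foldr (RawMonoid._∙_ M) (RawMonoid.ε M)) (≡.sym (map-∘ xs))

fold-cong : ∀ {c ℓ a} (M : RawMonoid c ℓ) {A : Set a} (xs : List A) {f g : A → RawMonoid.Carrier M} →
  (∀ x → f x ≡ g x) → fold M xs f ≡ fold M xs g
fold-cong M xs f≡g = ≡.cong (foldr (RawMonoid._∙_ M) (RawMonoid.ε M)) (map-cong f≡g xs)

fold-allFin-suc : ∀ {c ℓ} (M : RawMonoid c ℓ) (f : Fin (suc n) → RawMonoid.Carrier M) →
  fold M (allFin (suc n)) f ≡ RawMonoid._∙_ M (f Fin.zero) (fold M (allFin n) (f ∘ Fin.suc))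
fold-allFin-suc {n} M f = ≡.cong (RawMonoid._∙_ M (f Fin.zero))
  (≡.trans (≡.cong (λ xs → fold M xs f) (≡.sym (map-tabulate (λ i → i) Fin.suc))) (fold-map M Fin.suc (allFin n) f))

-- The monoid of functions is spelled out with an arbitrary relation as its equality, so that
-- `𝒢-+-rawMonoid` is an instance by definition and a coordinate of `γ` can be taken inside the sum.
fold-pointwise : ∀ {a b c ℓ ℓ′} {A : Set a} {B : Set b} (N : RawMonoid c ℓ)
  (_≋_ : (B → RawMonoid.Carrier N) → (B → RawMonoid.Carrier N) → Set ℓ′)
  (xs : List A) (f : A → B → RawMonoid.Carrier N) (y : B) →
  fold (record { Carrier = B → RawMonoid.Carrier N ; _≈_ = _≋_
               ; _∙_ = λ g h z → RawMonoid._∙_ N (g z) (h z) ; ε = λ _ → RawMonoid.ε N }) xs f y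
    ≡ fold N xs (λ x → f x y)
fold-pointwise N _≋_ []       f y = ≡.refl
fold-pointwise N _≋_ (x ∷ xs) f y = ≡.cong (RawMonoid._∙_ N (f x y)) (fold-pointwise N _≋_ xs f y)

module Sums {c ℓ : Level} (S : CommutativeSemiring c ℓ) where
  open CommutativeSemiring S
  open import Algebra.Properties.Semiring.Mult semiring public
    using (×-homo-+) renaming (_×_ to _×ˢ_; ×1-homo-* to ι-*)
  open import Algebra.Properties.CommutativeSemigroup +-commutativeSemigroup using (interchange)

  ∑ : List A → (A → Carrier) → Carrier
  ∑ = fold +-rawMonoid

  χ : Dec P → Carrier
  χ d = if does d then 1# else 0#

  private
    variable
      f g : A → Carrier

  ∑-cong-∈ : (xs : List A) → (∀ {x} → x ∈ˡ xs → f x ≈ g x) → ∑ xs f ≈ ∑ xs g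
  ∑-cong-∈ []       f≈g = refl
  ∑-cong-∈ (x ∷ xs) f≈g = +-cong (f≈g (here ≡.refl)) (∑-cong-∈ xs (λ x∈ → f≈g (there x∈)))

  ∑-cong : (xs : List A) → (∀ x → f x ≈ g x) → ∑ xs f ≈ ∑ xs g
  ∑-cong xs f≈g = ∑-cong-∈ xs (λ {x} _ → f≈g x)

  ∑-zero : (xs : List A) → ∑ xs (λ _ → 0#) ≈ 0#
  ∑-zero []       = refl
  ∑-zero (x ∷ xs) = trans (+-identityˡ _) (∑-zero xs)

  ∑-+ : (xs : List A) (f g : A → Carrier) → ∑ xs (λ x → f x + g x) ≈ ∑ xs f + ∑ xs g
  ∑-+ []       f g = sym (+-identityˡ 0#)
  ∑-+ (x ∷ xs) f g = trans (+-congˡ (∑-+ xs f g)) (interchange _ _ _ _)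

  ∑-*ˡ : (xs : List A) (k : Carrier) (f : A → Carrier) → ∑ xs (λ x → k * f x) ≈ k * ∑ xs f
  ∑-*ˡ []       k f = sym (zeroʳ k)
  ∑-*ˡ (x ∷ xs) k f = trans (+-congˡ (∑-*ˡ xs k f)) (sym (distribˡ k _ _))

  ∑-*ʳ : (xs : List A) (f : A → Carrier) (k : Carrier) → ∑ xs (λ x → f x * k) ≈ ∑ xs f * k
  ∑-*ʳ xs f k = trans (∑-cong xs λ x → *-comm (f x) k) (trans (∑-*ˡ xs k f) (*-comm k _))

  ∑-swap : (xs : List A) (ys : List B) (f : A → B → Carrier) →
           ∑ xs (λ x → ∑ ys (f x)) ≈ ∑ ys (λ y → ∑ xs (λ x → f x y))
  ∑-swap []       ys f = sym (∑-zero ys)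
  ∑-swap (x ∷ xs) ys f = trans (+-congˡ (∑-swap xs ys f)) (sym (∑-+ ys _ _))

  ∑-++ : (xs ys : List A) → ∑ (xs ++ ys) f ≈ ∑ xs f + ∑ ys f
  ∑-++ []       ys = sym (+-identityˡ _)
  ∑-++ (x ∷ xs) ys = trans (+-congˡ (∑-++ xs ys)) (sym (+-assoc _ _ _))

  ∑-map : (h : A → B) (xs : List A) → ∑ (List.map h xs) f ≡ ∑ xs (λ x → f (h x))
  ∑-map h xs = fold-map +-rawMonoid h xs _

  ∑-cartesianProductWith : ∀ {d} {D : Set d} {f : D → Carrier} (h : A → B → D)
    (xs : List A) (ys : List B) →
    ∑ (cartesianProductWith h xs ys) f ≈ ∑ xs (λ x → ∑ ys (λ y → f (h x y)))
  ∑-cartesianProductWith h []       ys = refl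
  ∑-cartesianProductWith h (x ∷ xs) ys =
    trans (∑-++ (List.map (h x) ys) _)
      (+-cong (reflexive (∑-map (h x) ys)) (∑-cartesianProductWith h xs ys))

  χ-true : (d : Dec P) → P → χ d ≡ 1#
  χ-true (yes _) _ = ≡.refl
  χ-true (no ¬x) x = contradiction x ¬x

  χ-false : (d : Dec P) → ¬ P → χ d ≡ 0#
  χ-false (yes x) ¬x = contradiction x ¬x
  χ-false (no _)  _  = ≡.refl

  χ-⇔ : (d : Dec P) (e : Dec Q) → (P → Q) → (Q → P) → χ d ≡ χ e
  χ-⇔ (yes x) e to from = ≡.sym (χ-true e (to x))
  χ-⇔ (no ¬x) e to from = ≡.sym (χ-false e (λ y → ¬x (from y)))

  χ-× : (d : Dec P) (e : Dec Q) → χ (d ×-dec e) ≈ χ d * χ e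
  χ-× (yes _) e = sym (*-identityˡ _)
  χ-× (no _)  e = sym (zeroˡ _)

  χ-+ : (d : Dec P) (e : Dec Q) (f : Dec T) →
        (P → T) → (Q → T) → (P → ¬ Q) → (T → P ⊎ Q) → χ d + χ e ≈ χ f
  χ-+ (yes x) e f P→T _ P→¬Q _ = trans (+-congˡ (reflexive (χ-false e (P→¬Q x))))
    (trans (+-identityʳ 1#) (reflexive (≡.sym (χ-true f (P→T x)))))
  χ-+ (no ¬x) e f _ Q→T _ T→P⊎Q = trans (+-identityˡ _) (reflexive (χ-⇔ e f Q→T λ z →
    [ (λ x → contradiction x ¬x) , (λ y → y) ] (T→P⊎Q z)))

  -- This is how hypotheses such as `e ∉ p` reach the inside of a sum over all elements.
  χ-*-cong : (d : Dec P) {x y : Carrier} → (P → x ≈ y) → χ d * x ≈ χ d * y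
  χ-*-cong (yes z) x≈y = *-congˡ (x≈y z)
  χ-*-cong (no _)  _   = trans (zeroˡ _) (sym (zeroˡ _))

  ∑-filter : {P : Pred A p} (P? : Decidable P) (xs : List A) →
             ∑ (filter P? xs) f ≈ ∑ xs (λ x → χ (P? x) * f x)
  ∑-filter P? []       = refl
  ∑-filter P? (x ∷ xs) with P? x
  ... | yes _ = +-cong (sym (*-identityˡ _)) (∑-filter P? xs)
  ... | no _  = trans (∑-filter P? xs) (trans (sym (+-identityˡ _)) (+-congʳ (sym (zeroˡ _))))

  ∑-χ-none : {P : Pred A p} (P? : Decidable P) {xs : List A} →
             AllL.All (λ x → ¬ P x) xs → ∑ xs (λ x → χ (P? x) * f x) ≈ 0#
  ∑-χ-none P? AllL.[]         = refl
  ∑-χ-none P? (¬x AllL.∷ ¬xs) = trans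
    (+-cong (trans (*-congʳ (reflexive (χ-false (P? _) ¬x))) (zeroˡ _)) (∑-χ-none P? ¬xs))
    (+-identityˡ 0#)

  -- Serves in place of a bijection. It is applied to the closure of an extended set, to the
  -- composition of a flag, to the composition of a bit sequence and to the size of a subset; read
  -- backwards, it introduces a new summation variable.
  ∑-χ-unique : {P : Pred A p} (P? : Decidable P) {xs : List A} {t : A} →
    Unique xs → t ∈ˡ xs → P t → (∀ {x} → P x → x ≡ t) →
    ∑ xs (λ x → χ (P? x) * f x) ≈ f t
  ∑-χ-unique P? (x∉ AllPairs.∷ _) (here ≡.refl) Pt only = trans
    (+-cong (trans (*-congʳ (reflexive (χ-true (P? _) Pt))) (*-identityˡ _))
            (∑-χ-none P? (AllL.map (λ t≢y Py → t≢y (≡.sym (only Py))) x∉)))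
    (+-identityʳ _)
  ∑-χ-unique P? (x∉ AllPairs.∷ u) (there t∈) Pt only = trans
    (+-cong (trans (*-congʳ (reflexive (χ-false (P? _) λ Px → AllL.lookup x∉ t∈ (only Px)))) (zeroˡ _))
            (∑-χ-unique P? u t∈ Pt only))
    (+-identityˡ _)

  -- The canonical image of a natural number. Over the field it agrees by definition with `fromℤ` on
  -- non-negative integers.
  ι : ℕ → Carrier
  ι k = k ×ˢ 1#

  ι-1 : ι 1 ≈ 1#
  ι-1 = +-identityʳ 1#

module Σℕ = Sums ℕₚ.+-*-commutativeSemiring

module Cast {c ℓ : Level} (S : CommutativeSemiring c ℓ) where
  open CommutativeSemiring S
  open Sums S

  ι-∑ : (xs : List A) (f : A → ℕ) → ι (Σℕ.∑ xs f) ≈ ∑ xs (λ x → ι (f x))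
  ι-∑ []       f = refl
  ι-∑ (x ∷ xs) f = trans (×-homo-+ 1# (f x) (Σℕ.∑ xs f)) (+-congˡ (ι-∑ xs f))

  ι-χ : (d : Dec P) → ι (Σℕ.χ d) ≈ χ d
  ι-χ (yes _) = ι-1
  ι-χ (no _)  = refl

length-filter : {P : Pred A p} (P? : Decidable P) (xs : List A) →
                length (filter P? xs) ≡ Σℕ.∑ xs (λ x → Σℕ.χ (P? x))
length-filter P? []       = ≡.refl
length-filter P? (x ∷ xs) with P? x
... | yes _ = ≡.cong suc (length-filter P? xs)
... | no _  = length-filter P? xs

-- The enumerations are complete and free of repetitions

module Enumeration where
  open ≡ using (refl; sym; trans; cong; subst)

  vectors-unique : ∀ {a} {A : Set a} {xs : List A} k → Unique xs → Unique (vectors xs k)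
  vectors-unique zero    u = AllL.[] AllPairs.∷ AllPairs.[]
  vectors-unique (suc k) u = Uniqueₚ.cartesianProductWith⁺ _∷_ ∷-injective u (vectors-unique k u)

  vectors-complete : ∀ {a} {A : Set a} {xs : List A} → (∀ x → x ∈ˡ xs) → (v : Vec A k) → v ∈ˡ vectors xs k
  vectors-complete all []      = here refl
  vectors-complete all (x ∷ v) = ∈-cartesianProductWith⁺ _∷_ (all x) (vectors-complete all v)

  subsets-unique : ∀ n → Unique (subsets n)
  subsets-unique n = vectors-unique n
    (((λ ()) AllL.∷ AllL.[]) AllPairs.∷ AllL.[] AllPairs.∷ AllPairs.[])

  subsets-complete : (p : Subset n) → p ∈ˡ subsets n
  subsets-complete = vectors-complete λ where
    outside → here refl
    inside  → there (here refl)

  sequences-unique : ∀ n r → Unique (sequences n r)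
  sequences-unique zero    zero    = AllL.[] AllPairs.∷ AllPairs.[]
  sequences-unique zero    (suc r) = AllPairs.[]
  sequences-unique (suc n) zero    = Uniqueₚ.map⁺ (λ { refl → refl }) (sequences-unique n zero)
  sequences-unique (suc n) (suc r) = Uniqueₚ.++⁺
    (Uniqueₚ.map⁺ (λ { refl → refl }) (sequences-unique n (suc r)))
    (Uniqueₚ.map⁺ (λ { refl → refl }) (sequences-unique n r))
    disjoint
    where
    disjoint : ∀ {s} → s ∈ˡ List.map 0∷_ (sequences n (suc r)) × s ∈ˡ List.map 1∷_ (sequences n r) → _
    disjoint (s∈ , s∈′) with ∈-map⁻ 0∷_ s∈ | ∈-map⁻ 1∷_ s∈′
    ... | _ , _ , refl | _ , _ , ()

  sequences-complete : (s : Sequence n r) → s ∈ˡ sequences n r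
  sequences-complete []               = here refl
  sequences-complete {r = zero}  (0∷ s) = ∈-map⁺ 0∷_ (sequences-complete s)
  sequences-complete {r = suc _} (0∷ s) = ∈-++⁺ˡ (∈-map⁺ 0∷_ (sequences-complete s))
  sequences-complete {suc n} {suc r} (1∷ s) =
    ∈-++⁺ʳ (List.map 0∷_ (sequences n (suc r))) (∈-map⁺ 1∷_ (sequences-complete s))

  compositions-unique : ∀ n r → Unique (compositions n r)
  compositions-unique n r = Uniqueₚ.map⁺ injective (sequences-unique n r)
    where
    injective : ∀ {s t : Sequence n r} → fromSequence s ≡ fromSequence t → s ≡ t
    injective {s} {t} eq = trans (sym (toSequence-fromSequence s))
      (trans (cong toSequence eq) (toSequence-fromSequence t))

  compositions-complete : (a : Composition n r) → a ∈ˡ compositions n r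
  compositions-complete a = subst (_∈ˡ _) (fromSequence-toSequence a)
    (∈-map⁺ fromSequence (sequences-complete (toSequence a)))

  composition-cong : {a b : Composition n r} → Composition.first a ≡ Composition.first b →
                     Composition.rest a ≡ Composition.rest b → a ≡ b
  composition-cong {a = composition _ _ p t} {composition _ _ q u} refl refl
    rewrite All.irrelevant ℕₚ.≤-irrelevant p q | ℕₚ.≡-irrelevant t u = refl

open Enumeration

-- Cardinalities of subsets

module Subsets where
  open ≡ using (refl; sym; trans; cong; subst)
  open import Data.Nat using (_+_)
  open Σℕ

  infix 4 _≟ˢ_
  _≟ˢ_ : (p q : Subset n) → Dec (p ≡ q)
  _≟ˢ_ = ≡-dec Bool._≟_

  p∪⁅x⁆⊆q : {p q : Subset n} {x : Fin n} → p ⊆ q → x ∈ q → p ∪ ⁅ x ⁆ ⊆ q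
  p∪⁅x⁆⊆q {p = p} {x = x} p⊆q x∈q y∈ with x∈p∪q⁻ p ⁅ x ⁆ y∈
  ... | inj₁ y∈p = p⊆q y∈p
  ... | inj₂ y∈x = subst (_∈ _) (sym (x∈⁅y⁆⇒x≡y x y∈x)) x∈q

  x∈p∪⁅x⁆ : (p : Subset n) (x : Fin n) → x ∈ p ∪ ⁅ x ⁆
  x∈p∪⁅x⁆ p x = q⊆p∪q p ⁅ x ⁆ (x∈⁅x⁆ x)

  ∣p∪⁅x⁆∣ : (p : Subset n) (x : Fin n) → x ∉ p → ∣ p ∪ ⁅ x ⁆ ∣ ≡ suc ∣ p ∣
  ∣p∪⁅x⁆∣ (true  ∷ p) Fin.zero    x∉ = contradiction Vec.here x∉
  ∣p∪⁅x⁆∣ (false ∷ p) Fin.zero    x∉ = cong (λ q → suc ∣ q ∣) (∪-identityʳ p)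
  ∣p∪⁅x⁆∣ (true  ∷ p) (Fin.suc x) x∉ = cong suc (∣p∪⁅x⁆∣ p x λ x∈ → x∉ (Vec.there x∈))
  ∣p∪⁅x⁆∣ (false ∷ p) (Fin.suc x) x∉ = ∣p∪⁅x⁆∣ p x λ x∈ → x∉ (Vec.there x∈)

  ∑-∈ : (p : Subset n) → ∑ (allFin n) (λ x → χ (x ∈? p)) ≡ ∣ p ∣
  ∑-∈ []      = refl
  ∑-∈ (s ∷ p) = trans (fold-allFin-suc ℕ.+-0-rawMonoid λ x → χ (x ∈? s ∷ p)) (trans
    (cong (χ (Fin.zero ∈? s ∷ p) +_)
      (trans (∑-cong (allFin _) λ x → χ-⇔ (Fin.suc x ∈? s ∷ p) (x ∈? p) drop-there Vec.there) (∑-∈ p)))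
    (head s))
    where
    head : ∀ s → χ (Fin.zero ∈? s ∷ p) + ∣ p ∣ ≡ ∣ s ∷ p ∣
    head true  = refl
    head false = refl

  ∑-∈∖ : {p q : Subset n} → p ⊆ q →
          ∑ (allFin n) (λ x → χ ((x ∈? q) ×-dec ¬? (x ∈? p))) ≡ ∣ q ∣ ∸ ∣ p ∣
  ∑-∈∖ {n} {p} {q} p⊆q = begin
    -- Adding and removing `∣ p ∣` avoids reasoning about truncated subtraction: the indicators of
    -- `p` and of its complement in `q` merge into that of `q`.
    D                          ≡⟨ ℕₚ.m+n∸n≡m D ∣ p ∣ ⟨
    D + ∣ p ∣ ∸ ∣ p ∣           ≡⟨ cong (λ z → D + z ∸ ∣ p ∣) (∑-∈ p) ⟨
    D + ∑ (allFin n) (λ x → χ (x ∈? p)) ∸ ∣ p ∣  ≡⟨ cong (_∸ ∣ p ∣) (∑-+ (allFin n) _ _) ⟨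
    ∑ (allFin n) (λ x → χ ((x ∈? q) ×-dec ¬? (x ∈? p)) + χ (x ∈? p)) ∸ ∣ p ∣
                               ≡⟨ cong (_∸ ∣ p ∣) (∑-cong (allFin n) split) ⟩
    ∑ (allFin n) (λ x → χ (x ∈? q)) ∸ ∣ p ∣      ≡⟨ cong (_∸ ∣ p ∣) (∑-∈ q) ⟩
    ∣ q ∣ ∸ ∣ p ∣               ∎
    where
    open ≡-Reasoning
    D : ℕ
    D = ∑ (allFin n) λ x → χ ((x ∈? q) ×-dec ¬? (x ∈? p))

    split : ∀ x → χ ((x ∈? q) ×-dec ¬? (x ∈? p)) + χ (x ∈? p) ≡ χ (x ∈? q)
    split x with x ∈? q | x ∈? p
    ... | yes _   | yes _   = refl
    ... | yes _   | no _    = refl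
    ... | no x∉q  | yes x∈p = contradiction (p⊆q x∈p) x∉q
    ... | no _    | no _    = refl

  ⊆∧∣∣≡⇒≡ : {p q : Subset n} → p ⊆ q → ∣ q ∣ ≡ ∣ p ∣ → q ≡ p
  ⊆∧∣∣≡⇒≡ {p = p} {q} p⊆q eq = ⊆-antisym q⊆p p⊆q
    where
    q⊆p : q ⊆ p
    q⊆p {x} x∈q with x ∈? p
    ... | yes x∈p = x∈p
    ... | no x∉p  = contradiction (p⊂q⇒∣p∣<∣q∣ ((λ {y} → p⊆q {y}) , x , x∈q , x∉p)) (ℕₚ.<-irrefl (sym eq))

open Subsets

-- The closure operator and flats, from the rank axioms

module Closure (M : Matroid n) where
  open ≡ using (refl; sym; trans; cong; subst)
  open import Data.Nat using (_+_)
  open Matroid M public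

  rk-⊥ : rk ⊥ ≡ 0
  rk-⊥ = ℕₚ.n≤0⇒n≡0 (subst (rk ⊥ ≤_) (∣⊥∣≡0 n) (rk-bounded ⊥))

  rk-insert-≥ : ∀ p e → rk p ≤ rk (p ∪ ⁅ e ⁆)
  rk-insert-≥ p e = rk-mono (p⊆p∪q {p = p} ⁅ e ⁆)

  rk-insert-≤ : ∀ p e → rk (p ∪ ⁅ e ⁆) ≤ suc (rk p)
  rk-insert-≤ p e = begin
    rk (p ∪ ⁅ e ⁆)                    ≤⟨ ℕₚ.m≤m+n _ _ ⟩
    rk (p ∪ ⁅ e ⁆) + rk (p ∩ ⁅ e ⁆)   ≤⟨ rk-submod p ⁅ e ⁆ ⟩
    rk p + rk ⁅ e ⁆                   ≤⟨ ℕₚ.+-monoʳ-≤ (rk p) (rk-bounded ⁅ e ⁆) ⟩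
    rk p + ∣ ⁅ e ⁆ ∣                  ≡⟨ cong (rk p +_) (∣⁅x⁆∣≡1 e) ⟩
    rk p + 1                          ≡⟨ ℕₚ.+-comm (rk p) 1 ⟩
    suc (rk p)                        ∎
    where open ℕₚ.≤-Reasoning

  -- Diminishing returns. The union of `q` and `p ∪ ⁅ e ⁆` contains `q ∪ ⁅ e ⁆` and their
  -- intersection contains `p`, so submodularity and monotonicity suffice.
  rk-insert-submod : ∀ {p q} e → p ⊆ q → rk (q ∪ ⁅ e ⁆) + rk p ≤ rk q + rk (p ∪ ⁅ e ⁆)
  rk-insert-submod {p} {q} e p⊆q = ℕₚ.≤-trans
    (ℕₚ.+-mono-≤
      (rk-mono (p∪⁅x⁆⊆q {p = q} (p⊆p∪q {p = q} _) (q⊆p∪q q _ (x∈p∪⁅x⁆ p e))))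
      (rk-mono λ x∈p → x∈p∩q⁺ (p⊆q x∈p , p⊆p∪q {p = p} _ x∈p)))
    (rk-submod q (p ∪ ⁅ e ⁆))

  cl : Subset n → Subset n
  cl p = Vec.tabulate λ e → does (rk (p ∪ ⁅ e ⁆) ℕ.≟ rk p)

  ∈cl⁻ : ∀ {p e} → e ∈ cl p → rk (p ∪ ⁅ e ⁆) ≡ rk p
  ∈cl⁻ {p} {e} e∈ = does≡true (rk (p ∪ ⁅ e ⁆) ℕ.≟ rk p)
    (trans (sym (lookup∘tabulate _ e)) ([]=⇒lookup e∈))
    where
    does≡true : ∀ {P : Set} (d : Dec P) → does d ≡ true → P
    does≡true (yes x) _ = x

  ∈cl⁺ : ∀ {p e} → rk (p ∪ ⁅ e ⁆) ≡ rk p → e ∈ cl p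
  ∈cl⁺ {p} {e} eq = lookup⇒[]= e (cl p)
    (trans (lookup∘tabulate _ e) (dec-true (rk (p ∪ ⁅ e ⁆) ℕ.≟ rk p) eq))

  p⊆cl : ∀ {p} → p ⊆ cl p
  p⊆cl {p} e∈p = ∈cl⁺ (ℕₚ.≤-antisym (rk-mono (p∪⁅x⁆⊆q {p = p} (λ x∈ → x∈) e∈p)) (rk-insert-≥ p _))

  private
    adjoin : Subset n → List (Fin n) → Subset n
    adjoin p = foldr (λ e q → q ∪ ⁅ e ⁆) p

    p⊆adjoin : ∀ p es → p ⊆ adjoin p es
    p⊆adjoin p []       x∈ = x∈
    p⊆adjoin p (e ∷ es) x∈ = p⊆p∪q {p = adjoin p es} _ (p⊆adjoin p es x∈)

    es⊆adjoin : ∀ p {es e} → e ∈ˡ es → e ∈ adjoin p es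
    es⊆adjoin p {e ∷ es} (here refl) = x∈p∪⁅x⁆ (adjoin p es) e
    es⊆adjoin p {_ ∷ es} (there e∈)  = p⊆p∪q {p = adjoin p es} _ (es⊆adjoin p e∈)

    -- By diminishing returns, an element that does not raise the rank of `p` does not raise the
    -- rank of the larger set built so far either.
    rk-adjoin : ∀ p {es} → AllL.All (_∈ cl p) es → rk (adjoin p es) ≤ rk p
    rk-adjoin p AllL.[] = ℕₚ.≤-refl
    rk-adjoin p {e ∷ es} (e∈ AllL.∷ es⊆) = ℕₚ.+-cancelʳ-≤ (rk p) _ _ (ℕₚ.≤-trans
      (rk-insert-submod e (p⊆adjoin p es))
      (ℕₚ.+-mono-≤ (rk-adjoin p es⊆) (ℕₚ.≤-reflexive (∈cl⁻ e∈))))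

  rk-cl : ∀ p → rk (cl p) ≡ rk p
  rk-cl p = ℕₚ.≤-antisym
    -- `cl p` lies inside the set obtained from `p` by adjoining the list of all elements of `cl p`.
    (ℕₚ.≤-trans (rk-mono λ {e} e∈ → es⊆adjoin p (∈-filter⁺ (_∈? cl p) (∈-allFin e) e∈))
                (rk-adjoin p (all-filter (_∈? cl p) (allFin n))))
    (rk-mono (p⊆cl {p}))

  cl-flat : ∀ p → IsFlat (cl p)
  cl-flat p e e∉ = begin-strict
    rk (cl p)         ≡⟨ rk-cl p ⟩
    rk p              <⟨ ℕₚ.≤∧≢⇒< (rk-insert-≥ p e) (λ eq → e∉ (∈cl⁺ (sym eq))) ⟩
    rk (p ∪ ⁅ e ⁆)    ≤⟨ rk-mono (p∪⁅x⁆⊆q {p = p} (λ x∈ → p⊆p∪q {p = cl p} _ (p⊆cl x∈)) (x∈p∪⁅x⁆ (cl p) e)) ⟩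
    rk (cl p ∪ ⁅ e ⁆) ∎
    where open ℕₚ.≤-Reasoning

  -- An element of `cl p` outside `X` would raise the rank of the flat `X` but not that of its
  -- subset `p`, against diminishing returns.
  cl⊆flat : ∀ {p X} → IsFlat X → p ⊆ X → cl p ⊆ X
  cl⊆flat {p} {X} flat p⊆X {e} e∈ with e ∈? X
  ... | yes e∈X = e∈X
  ... | no e∉X  = contradiction (flat e e∉X) (ℕₚ.≤⇒≯ (ℕₚ.+-cancelʳ-≤ (rk p) _ _
    (subst (λ z → rk (X ∪ ⁅ e ⁆) + rk p ≤ rk X + z) (∈cl⁻ e∈) (rk-insert-submod e p⊆X))))

  -- For `e` in `X` the set `p ∪ ⁅ e ⁆` still lies in `X`, so its rank cannot exceed that of `p`.
  -- This is the tool for recognizing a flat: the bottom of a flag, the flat after a stall and the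
  -- flat after a climb.
  flat≡cl : ∀ {p X} → IsFlat X → p ⊆ X → rk X ≡ rk p → X ≡ cl p
  flat≡cl {p} {X} flat p⊆X rk≡ = ⊆-antisym
    (λ {e} e∈X → ∈cl⁺ (ℕₚ.≤-antisym
      (subst (rk (p ∪ ⁅ e ⁆) ≤_) rk≡ (rk-mono (p∪⁅x⁆⊆q {p = p} p⊆X e∈X)))
      (rk-insert-≥ p e)))
    (cl⊆flat flat p⊆X)

-- The number of ways to continue an ordering by the bits s when d elements of
-- the current flat are still unplaced and the remaining steps of the flag have
-- the sizes as (each at least 1, so that pred does not truncate).
fillings : ℕ → Vec ℕ l → Sequence k l → ℕ
fillings d as       []     = 1
fillings d as       (0∷ s) = d ℕ.* fillings (pred d) as s
fillings d (a ∷ as) (1∷ s) = a ℕ.* fillings (pred (d ℕ.+ a)) as s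

-- Counting orderings along flags of flats

module Flags (M : Matroid n) where
  open ≡ using (refl; sym; trans; cong; cong₂; subst)
  open import Data.Nat using (_+_; _*_)
  open Closure M
  open Σℕ
  open ≡-Reasoning

  stalls? : ∀ p e → Dec (e ∉ p × rk (p ∪ ⁅ e ⁆) ≡ rk p)
  stalls? p e = ¬? (e ∈? p) ×-dec (rk (p ∪ ⁅ e ⁆) ℕ.≟ rk p)

  climbs? : ∀ p e → Dec (e ∉ p × rk (p ∪ ⁅ e ⁆) ≡ suc (rk p))
  climbs? p e = ¬? (e ∈? p) ×-dec (rk (p ∪ ⁅ e ⁆) ℕ.≟ suc (rk p))

  -- The number of ways to adjoin elements one by one to p so that the rank
  -- increments are the bits of s.
  orderings : Subset n → Sequence k l → ℕ
  orderings p []     = 1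
  orderings p (0∷ s) = ∑ (allFin n) λ e → χ (stalls? p e) * orderings (p ∪ ⁅ e ⁆) s
  orderings p (1∷ s) = ∑ (allFin n) λ e → χ (climbs? p e) * orderings (p ∪ ⁅ e ⁆) s

  infix 4 _⋖_ _⋖?_
  _⋖_ : Subset n → Subset n → Set
  X ⋖ Y = IsFlat Y × X ⊂ Y × rk Y ≡ suc (rk X)

  _⋖?_ : ∀ X Y → Dec (X ⋖ Y)
  X ⋖? Y = isFlat? Y ×-dec (X ⊂? Y ×-dec (rk Y ℕ.≟ suc (rk X)))

  Chain : Subset n → Vec (Subset n) l → Set
  Chain X []       = Unit
  Chain X (Y ∷ Ys) = X ⋖ Y × Chain Y Ys

  chain? : ∀ X (Ys : Vec (Subset n) l) → Dec (Chain X Ys)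
  chain? X []       = yes tt
  chain? X (Y ∷ Ys) = (X ⋖? Y) ×-dec chain? Y Ys

  steps : Subset n → Vec (Subset n) l → Vec ℕ l
  steps X []       = []
  steps X (Y ∷ Ys) = ∣ Y ∣ ∸ ∣ X ∣ ∷ steps Y Ys

  -- Sums a statistic of the step sizes over all chains that continue from `X`. Leaving `Φ`
  -- arbitrary lets `∑-chains-suc` absorb the first step size into it.
  ∑-chains : Subset n → (Vec ℕ l → ℕ) → ℕ
  ∑-chains {l} X Φ = ∑ (vectors (subsets n) l) λ Ys → χ (chain? X Ys) * Φ (steps X Ys)

  ∑-chains-* : ∀ X k (Φ : Vec ℕ l → ℕ) → ∑-chains X (λ v → k * Φ v) ≡ k * ∑-chains X Φ
  ∑-chains-* {l} X k Φ = trans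
    (∑-cong (vectors (subsets n) l) λ Ys → x∙yz≈y∙xz (χ (chain? X Ys)) k (Φ (steps X Ys)))
    (∑-*ˡ (vectors (subsets n) l) k _)
    where open import Algebra.Properties.CommutativeSemigroup ℕₚ.*-commutativeSemigroup using (x∙yz≈y∙xz)

  ∑-chains-suc : ∀ X (Φ : Vec ℕ (suc l) → ℕ) →
    ∑-chains X Φ ≡ ∑ (subsets n) (λ Y → χ (X ⋖? Y) * ∑-chains Y (λ v → Φ (∣ Y ∣ ∸ ∣ X ∣ ∷ v)))
  ∑-chains-suc {l} X Φ = trans
    (∑-cartesianProductWith _∷_ (subsets n) (vectors (subsets n) l))
    (∑-cong (subsets n) λ Y → trans
      (∑-cong (vectors (subsets n) l) λ Ys → trans
        (cong (_* Φ (steps X (Y ∷ Ys))) (χ-× (X ⋖? Y) (chain? Y Ys)))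
        (ℕₚ.*-assoc (χ (X ⋖? Y)) (χ (chain? Y Ys)) _))
      (∑-*ˡ (vectors (subsets n) l) (χ (X ⋖? Y)) _))

  -- With `cover⇒climb`, the equivalence behind the double count for bit 1: a climbing `e` together
  -- with the closure `Z` it generates, against a flat `Z` covering `cl p` together with an element
  -- of `Z` outside `cl p`.
  climb⇒cover : ∀ {p e Z} → (e ∉ p × rk (p ∪ ⁅ e ⁆) ≡ suc (rk p)) × Z ≡ cl (p ∪ ⁅ e ⁆) →
                cl p ⋖ Z × (e ∈ Z × e ∉ cl p)
  climb⇒cover {p} {e} ((_ , climb) , refl) =
    (cl-flat _ , (cl⊆flat (cl-flat _) p⊆Z , e , e∈Z , e∉) ,
      trans (rk-cl _) (trans climb (cong suc (sym (rk-cl p))))) , e∈Z , e∉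
    where
    p⊆Z : p ⊆ cl (p ∪ ⁅ e ⁆)
    p⊆Z x∈ = p⊆cl {p ∪ ⁅ e ⁆} (p⊆p∪q {p = p} _ x∈)

    e∈Z : e ∈ cl (p ∪ ⁅ e ⁆)
    e∈Z = p⊆cl {p ∪ ⁅ e ⁆} (x∈p∪⁅x⁆ p e)

    e∉ : e ∉ cl p
    e∉ e∈ = ℕₚ.1+n≢n (trans (sym climb) (∈cl⁻ e∈))

  cover⇒climb : ∀ {p e Z} → cl p ⋖ Z × (e ∈ Z × e ∉ cl p) →
                (e ∉ p × rk (p ∪ ⁅ e ⁆) ≡ suc (rk p)) × Z ≡ cl (p ∪ ⁅ e ⁆)
  cover⇒climb {p} {e} ((flat , (cl⊆Z , _) , rkZ) , e∈Z , e∉) = ((λ e∈ → e∉ (p⊆cl e∈)) , climb) ,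
    flat≡cl flat (p∪⁅x⁆⊆q {p = p} (λ x∈ → cl⊆Z (p⊆cl x∈)) e∈Z)
      (trans rkZ (trans (cong suc (rk-cl p)) (sym climb)))
    where
    climb : rk (p ∪ ⁅ e ⁆) ≡ suc (rk p)
    climb = ℕₚ.≤-antisym (rk-insert-≤ p e)
      (ℕₚ.≤∧≢⇒< (rk-insert-≥ p e) λ eq → e∉ (∈cl⁺ (sym eq)))

  stall⇒cl≡ : ∀ p e → rk (p ∪ ⁅ e ⁆) ≡ rk p → cl p ≡ cl (p ∪ ⁅ e ⁆)
  stall⇒cl≡ p e eq = flat≡cl (cl-flat p) (p∪⁅x⁆⊆q {p = p} p⊆cl (∈cl⁺ eq)) (trans (rk-cl p) (sym eq))

  -- Induction on the bits. The parameter of `fillings` is the number of elements of `cl p` not yet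
  -- placed: a stall keeps `cl p` and enlarges `p` by one, while a climb replaces `cl p` by a flat
  -- covering it, so the sum over elements has to be turned into a sum over covering flats.
  orderings≡∑-chains : ∀ p (s : Sequence k l) →
    orderings p s ≡ ∑-chains (cl p) (λ v → fillings (∣ cl p ∣ ∸ ∣ p ∣) v s)
  orderings≡∑-chains p [] = refl
  orderings≡∑-chains p (0∷ s) = begin
    ∑ (allFin n) (λ e → χ (stalls? p e) * orderings (p ∪ ⁅ e ⁆) s)
      ≡⟨ ∑-cong (allFin n) (λ e → trans
           (χ-*-cong (stalls? p e) λ { (e∉ , eq) → trans (orderings≡∑-chains (p ∪ ⁅ e ⁆) s)
             (cong₂ (λ X m → ∑-chains X (λ v → fillings (∣ X ∣ ∸ m) v s))
               (sym (stall⇒cl≡ p e eq)) (∣p∪⁅x⁆∣ p e e∉)) })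
           (cong (_* rest) (χ-⇔ (stalls? p e) ((e ∈? cl p) ×-dec ¬? (e ∈? p))
             (λ { (e∉ , eq) → ∈cl⁺ eq , e∉ }) (λ { (e∈ , e∉) → e∉ , ∈cl⁻ e∈ })))) ⟩
    ∑ (allFin n) (λ e → χ ((e ∈? cl p) ×-dec ¬? (e ∈? p)) * rest)
      ≡⟨ ∑-*ʳ (allFin n) _ rest ⟩
    ∑ (allFin n) (λ e → χ ((e ∈? cl p) ×-dec ¬? (e ∈? p))) * rest
      ≡⟨ cong (_* rest) (∑-∈∖ {p = p} p⊆cl) ⟩
    d * rest
      ≡⟨ cong (λ m → d * ∑-chains (cl p) (λ v → fillings m v s)) (ℕₚ.pred[m∸n]≡m∸[1+n] ∣ cl p ∣ ∣ p ∣) ⟨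
    d * ∑-chains (cl p) (λ v → fillings (pred d) v s)
      ≡⟨ ∑-chains-* (cl p) d (λ v → fillings (pred d) v s) ⟨
    ∑-chains (cl p) (λ v → d * fillings (pred d) v s) ∎
    where
    d rest : ℕ
    d    = ∣ cl p ∣ ∸ ∣ p ∣
    rest = ∑-chains (cl p) (λ v → fillings (∣ cl p ∣ ∸ suc ∣ p ∣) v s)
  orderings≡∑-chains p (1∷ s) = begin
    ∑ (allFin n) (λ e → χ (climbs? p e) * orderings (p ∪ ⁅ e ⁆) s)
      ≡⟨ ∑-cong (allFin n) (λ e → trans
           (χ-*-cong (climbs? p e) λ { (e∉ , _) → trans (orderings≡∑-chains (p ∪ ⁅ e ⁆) s) (trans
             (cong (λ m → ∑-chains (cl (p ∪ ⁅ e ⁆)) (λ v → fillings (∣ cl (p ∪ ⁅ e ⁆) ∣ ∸ m) v s))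
               (∣p∪⁅x⁆∣ p e e∉))
             -- The closure after adjoining `e` becomes a summation variable `Z`, which allows the
             -- sums over `e` and over flats to be exchanged.
             (sym (∑-χ-unique (_≟ˢ cl (p ∪ ⁅ e ⁆)) (subsets-unique n) (subsets-complete _) refl (λ eq → eq)))) })
           (sym (∑-*ˡ (subsets n) (χ (climbs? p e)) _))) ⟩
    ∑ (allFin n) (λ e → ∑ (subsets n) (λ Z → χ (climbs? p e) * (χ (Z ≟ˢ cl (p ∪ ⁅ e ⁆)) * above Z)))
      ≡⟨ ∑-swap (allFin n) (subsets n) _ ⟩
    ∑ (subsets n) (λ Z → ∑ (allFin n) (λ e → χ (climbs? p e) * (χ (Z ≟ˢ cl (p ∪ ⁅ e ⁆)) * above Z)))
      ≡⟨ ∑-cong (subsets n) cover ⟩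
    ∑ (subsets n) (λ Z → χ (cl p ⋖? Z) * ∑-chains Z (λ v → fillings d (∣ Z ∣ ∸ ∣ cl p ∣ ∷ v) (1∷ s)))
      ≡⟨ ∑-chains-suc (cl p) (λ v → fillings d v (1∷ s)) ⟨
    ∑-chains (cl p) (λ v → fillings d v (1∷ s)) ∎
    where
    d : ℕ
    d = ∣ cl p ∣ ∸ ∣ p ∣

    above : Subset n → ℕ
    above Z = ∑-chains Z (λ v → fillings (∣ Z ∣ ∸ suc ∣ p ∣) v s)

    -- The right-hand side is the parameter that `fillings` passes on after a bit 1: the unplaced
    -- elements of the old flat and all those of the step, less the one just placed.
    free : ∀ {Z} → cl p ⊆ Z → ∣ Z ∣ ∸ suc ∣ p ∣ ≡ pred (d + (∣ Z ∣ ∸ ∣ cl p ∣))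
    free {Z} cl⊆Z = trans (sym (ℕₚ.pred[m∸n]≡m∸[1+n] ∣ Z ∣ ∣ p ∣)) (cong pred (begin
      ∣ Z ∣ ∸ ∣ p ∣                         ≡⟨ cong (_∸ ∣ p ∣) (ℕₚ.m∸n+n≡m (p⊆q⇒∣p∣≤∣q∣ cl⊆Z)) ⟨
      ∣ Z ∣ ∸ ∣ cl p ∣ + ∣ cl p ∣ ∸ ∣ p ∣     ≡⟨ ℕₚ.+-∸-assoc (∣ Z ∣ ∸ ∣ cl p ∣) (p⊆q⇒∣p∣≤∣q∣ (p⊆cl {p})) ⟩
      ∣ Z ∣ ∸ ∣ cl p ∣ + d                   ≡⟨ ℕₚ.+-comm _ d ⟩
      d + (∣ Z ∣ ∸ ∣ cl p ∣)                 ∎))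

    -- For a fixed `Z` covering `cl p`, the elements `e` that lead to it are those of `Z` outside
    -- `cl p`; their number is the step size, which is the factor `a` in `fillings`.
    cover : ∀ Z → ∑ (allFin n) (λ e → χ (climbs? p e) * (χ (Z ≟ˢ cl (p ∪ ⁅ e ⁆)) * above Z))
                  ≡ χ (cl p ⋖? Z) * ∑-chains Z (λ v → fillings d (∣ Z ∣ ∸ ∣ cl p ∣ ∷ v) (1∷ s))
    cover Z = begin
      ∑ (allFin n) (λ e → χ (climbs? p e) * (χ (Z ≟ˢ cl (p ∪ ⁅ e ⁆)) * above Z))
        ≡⟨ ∑-cong (allFin n) (λ e → begin
             χ (climbs? p e) * (χ (Z ≟ˢ cl (p ∪ ⁅ e ⁆)) * above Z)
               ≡⟨ ℕₚ.*-assoc (χ (climbs? p e)) _ _ ⟨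
             χ (climbs? p e) * χ (Z ≟ˢ cl (p ∪ ⁅ e ⁆)) * above Z
               ≡⟨ cong (_* above Z) (χ-× (climbs? p e) (Z ≟ˢ cl (p ∪ ⁅ e ⁆))) ⟨
             χ (climbs? p e ×-dec (Z ≟ˢ cl (p ∪ ⁅ e ⁆))) * above Z
               ≡⟨ cong (_* above Z) (χ-⇔ (climbs? p e ×-dec (Z ≟ˢ cl (p ∪ ⁅ e ⁆)))
                    ((cl p ⋖? Z) ×-dec ((e ∈? Z) ×-dec ¬? (e ∈? cl p)))
                    climb⇒cover cover⇒climb) ⟩
             χ ((cl p ⋖? Z) ×-dec ((e ∈? Z) ×-dec ¬? (e ∈? cl p))) * above Z
               ≡⟨ cong (_* above Z) (χ-× (cl p ⋖? Z) ((e ∈? Z) ×-dec ¬? (e ∈? cl p))) ⟩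
             χ (cl p ⋖? Z) * χ ((e ∈? Z) ×-dec ¬? (e ∈? cl p)) * above Z ∎) ⟩
      ∑ (allFin n) (λ e → χ (cl p ⋖? Z) * χ ((e ∈? Z) ×-dec ¬? (e ∈? cl p)) * above Z)
        ≡⟨ ∑-*ʳ (allFin n) _ (above Z) ⟩
      ∑ (allFin n) (λ e → χ (cl p ⋖? Z) * χ ((e ∈? Z) ×-dec ¬? (e ∈? cl p))) * above Z
        ≡⟨ cong (_* above Z) (∑-*ˡ (allFin n) (χ (cl p ⋖? Z)) _) ⟩
      χ (cl p ⋖? Z) * ∑ (allFin n) (λ e → χ ((e ∈? Z) ×-dec ¬? (e ∈? cl p))) * above Z
        ≡⟨ ℕₚ.*-assoc (χ (cl p ⋖? Z)) _ _ ⟩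
      χ (cl p ⋖? Z) * (∑ (allFin n) (λ e → χ ((e ∈? Z) ×-dec ¬? (e ∈? cl p))) * above Z)
        ≡⟨ χ-*-cong (cl p ⋖? Z) (λ { (_ , (cl⊆Z , _) , _) → trans
             (cong₂ (λ m m′ → m * ∑-chains Z (λ v → fillings m′ v s)) (∑-∈∖ {p = cl p} cl⊆Z) (free cl⊆Z))
             (sym (∑-chains-* Z (∣ Z ∣ ∸ ∣ cl p ∣) (λ v → fillings (pred (d + (∣ Z ∣ ∸ ∣ cl p ∣))) v s))) }) ⟩
      χ (cl p ⋖? Z) * ∑-chains Z (λ v → fillings d (∣ Z ∣ ∸ ∣ cl p ∣ ∷ v) (1∷ s)) ∎

  -- `IsFlag` prescribes the rank of each flat by its index, `Chain` only relative to the preceding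
  -- flat; the offset `m` bridges the two as the recursion moves to the tail.
  chain⁺ : ∀ m X (Ys : Vec (Subset n) l) →
    (∀ i → IsFlat (lookup (X ∷ Ys) i) × rk (lookup (X ∷ Ys) i) ≡ m + toℕ i) →
    (∀ i → lookup (X ∷ Ys) (inject₁ i) ⊂ lookup Ys i) → Chain X Ys
  chain⁺ m X []       flat sub = tt
  chain⁺ m X (Y ∷ Ys) flat sub =
    (proj₁ (flat (Fin.suc Fin.zero)) , sub Fin.zero , (begin
      rk Y         ≡⟨ proj₂ (flat (Fin.suc Fin.zero)) ⟩
      m + 1        ≡⟨ ℕₚ.+-suc m 0 ⟩
      suc (m + 0)  ≡⟨ cong suc (proj₂ (flat Fin.zero)) ⟨
      suc (rk X)   ∎)) ,
    chain⁺ (suc m) Y Ys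
      (λ i → proj₁ (flat (Fin.suc i)) , trans (proj₂ (flat (Fin.suc i))) (ℕₚ.+-suc m (toℕ i)))
      (sub ∘ Fin.suc)

  chain⁻ : ∀ m X (Ys : Vec (Subset n) l) → IsFlat X → rk X ≡ m → Chain X Ys →
    (∀ i → IsFlat (lookup (X ∷ Ys) i) × rk (lookup (X ∷ Ys) i) ≡ m + toℕ i) ×
    (∀ i → lookup (X ∷ Ys) (inject₁ i) ⊂ lookup Ys i)
  chain⁻ m X []       flat rk≡ _ = (λ { Fin.zero → flat , trans rk≡ (sym (ℕₚ.+-identityʳ m)) }) , λ ()
  chain⁻ m X (Y ∷ Ys) flat rk≡ ((flatY , X⊂Y , rkY) , chain)
    with chain⁻ (suc m) Y Ys flatY (trans rkY (cong suc rk≡)) chain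
  ... | flats , subs =
    (λ { Fin.zero    → flat , trans rk≡ (sym (ℕₚ.+-identityʳ m))
       ; (Fin.suc i) → proj₁ (flats i) , trans (proj₂ (flats i)) (sym (ℕₚ.+-suc m (toℕ i))) }) ,
    (λ { Fin.zero → X⊂Y ; (Fin.suc i) → subs i })

  lookup-steps : ∀ X (Ys : Vec (Subset n) l) i →
    lookup (steps X Ys) i ≡ ∣ lookup Ys i ∣ ∸ ∣ lookup (X ∷ Ys) (inject₁ i) ∣
  lookup-steps X (Y ∷ Ys) Fin.zero    = refl
  lookup-steps X (Y ∷ Ys) (Fin.suc i) = lookup-steps Y Ys i

  steps-positive : ∀ X (Ys : Vec (Subset n) l) → Chain X Ys → All (1 ≤_) (steps X Ys)
  steps-positive X []       _ = []
  steps-positive X (Y ∷ Ys) ((_ , X⊂Y , _) , chain) =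
    ℕₚ.m<n⇒0<n∸m (p⊂q⇒∣p∣<∣q∣ X⊂Y) ∷ steps-positive Y Ys chain

  flat-full : ∀ {X} → IsFlat X → rk X ≡ rank → ∣ X ∣ ≡ n
  flat-full {X} flat eq = trans (cong ∣_∣ (⊆-antisym (⊆⊤ {p = X}) all)) (∣⊤∣≡n n)
    where
    all : ⊤ ⊆ X
    all {e} _ with e ∈? X
    ... | yes e∈ = e∈
    ... | no e∉  = contradiction (flat e e∉) (ℕₚ.≤⇒≯ (subst (rk (X ∪ ⁅ e ⁆) ≤_) (sym eq) (rk-mono (⊆⊤ {p = X ∪ ⁅ e ⁆}))))

  -- The sizes telescope to that of the last flat, which has full rank and therefore contains every
  -- element.
  steps-total : ∀ X (Ys : Vec (Subset n) l) → IsFlat X → rk X + l ≡ rank → Chain X Ys →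
    ∣ X ∣ + Vec.sum (steps X Ys) ≡ n
  steps-total X []       flat eq _ =
    trans (ℕₚ.+-identityʳ _) (flat-full flat (trans (sym (ℕₚ.+-identityʳ _)) eq))
  steps-total {suc l} X (Y ∷ Ys) flat eq ((flatY , X⊂Y , rkY) , chain) = begin
    ∣ X ∣ + (∣ Y ∣ ∸ ∣ X ∣ + Vec.sum (steps Y Ys))
      ≡⟨ ℕₚ.+-assoc ∣ X ∣ _ _ ⟨
    ∣ X ∣ + (∣ Y ∣ ∸ ∣ X ∣) + Vec.sum (steps Y Ys)
      ≡⟨ cong (_+ Vec.sum (steps Y Ys)) (ℕₚ.m+[n∸m]≡n (ℕₚ.<⇒≤ (p⊂q⇒∣p∣<∣q∣ X⊂Y))) ⟩
    ∣ Y ∣ + Vec.sum (steps Y Ys)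
      ≡⟨ steps-total Y Ys flatY (trans (cong (_+ l) rkY) (trans (sym (ℕₚ.+-suc (rk X) l)) eq)) chain ⟩
    n ∎

  module _ (a : Composition n r) (X : Subset n) (Ys : Vec (Subset n) r) where
    open Composition a

    flag⇒chain : IsFlag M a (X ∷ Ys) →
      X ≡ cl ⊥ × Chain X Ys × first ≡ ∣ X ∣ × rest ≡ steps X Ys
    flag⇒chain (flats , subs , size₀ , sizes) =
      -- The bottom flat has rank 0, the rank of the empty set, so it is forced to be the closure of
      -- the empty set.
      flat≡cl (proj₁ (flats Fin.zero)) (⊥⊆ {p = X}) (trans (proj₂ (flats Fin.zero)) (sym rk-⊥)) ,
      chain⁺ 0 X Ys flats subs ,
      sym size₀ ,
      Pointwise-≡⇒≡ (ext λ i → trans (sym (sizes i)) (sym (lookup-steps X Ys i)))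

    chain⇒flag : X ≡ cl ⊥ → Chain X Ys → first ≡ ∣ X ∣ → rest ≡ steps X Ys → IsFlag M a (X ∷ Ys)
    chain⇒flag X≡ chain size₀ sizes = proj₁ flags , proj₂ flags , sym size₀ ,
      λ i → trans (sym (lookup-steps X Ys i)) (cong (λ v → lookup v i) (sym sizes))
      where
      flags : _
      flags = chain⁻ 0 X Ys (subst IsFlat (sym X≡) (cl-flat ⊥))
                (trans (cong rk X≡) (trans (rk-cl ⊥) rk-⊥)) chain

  -- A flag determines its composition, so after exchanging the sums over compositions and flags the
  -- inner one has at most one nonzero term.
  ∑-ν : rank ≡ r → (Φ : ℕ → Vec ℕ r → ℕ) →
    ∑ (compositions n r) (λ a → ν M a * Φ (Composition.first a) (Composition.rest a))
      ≡ ∑-chains (cl ⊥) (Φ ∣ cl ⊥ ∣)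
  ∑-ν {r} rank≡r Φ = begin
    ∑ as (λ a → ν M a * Φ′ a)
      ≡⟨ ∑-cong as (λ a → trans (cong (_* Φ′ a) (length-filter (isFlag? M a) Xs)) (sym (∑-*ʳ Xs _ (Φ′ a)))) ⟩
    ∑ as (λ a → ∑ Xs (λ X → χ (isFlag? M a X) * Φ′ a))
      ≡⟨ ∑-swap as Xs _ ⟩
    ∑ Xs (λ X → ∑ as (λ a → χ (isFlag? M a X) * Φ′ a))
      ≡⟨ ∑-cartesianProductWith _∷_ (subsets n) Yss ⟩
    ∑ (subsets n) (λ X → ∑ Yss (λ Ys → ∑ as (λ a → χ (isFlag? M a (X ∷ Ys)) * Φ′ a)))
      ≡⟨ ∑-cong (subsets n) (λ X → trans (∑-cong Yss (composition-of X))
           (∑-*ˡ Yss (χ (X ≟ˢ cl ⊥)) _)) ⟩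
    ∑ (subsets n) (λ X → χ (X ≟ˢ cl ⊥) * ∑-chains X (Φ ∣ X ∣))
      ≡⟨ ∑-χ-unique (_≟ˢ cl ⊥) (subsets-unique n) (subsets-complete _) refl (λ eq → eq) ⟩
    ∑-chains (cl ⊥) (Φ ∣ cl ⊥ ∣) ∎
    where
    as  = compositions n r
    Xs  = vectors (subsets n) (suc r)
    Yss = vectors (subsets n) r

    Φ′ : Composition n r → ℕ
    Φ′ a = Φ (Composition.first a) (Composition.rest a)

    composition-of : ∀ X Ys → ∑ as (λ a → χ (isFlag? M a (X ∷ Ys)) * Φ′ a)
                      ≡ χ (X ≟ˢ cl ⊥) * (χ (chain? X Ys) * Φ ∣ X ∣ (steps X Ys))
    composition-of X Ys with X ≟ˢ cl ⊥
    ... | no X≢ = ∑-χ-none (λ a → isFlag? M a (X ∷ Ys))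
                    (AllL.universal (λ a flag → X≢ (proj₁ (flag⇒chain a X Ys flag))) as)
    ... | yes X≡ with chain? X Ys
    ...   | no ¬chain = ∑-χ-none (λ a → isFlag? M a (X ∷ Ys))
                    (AllL.universal (λ a flag → ¬chain (proj₁ (proj₂ (flag⇒chain a X Ys flag)))) as)
    ...   | yes chain = trans
      (∑-χ-unique (λ a → isFlag? M a (X ∷ Ys)) (compositions-unique n r) (compositions-complete a*)
        (chain⇒flag a* X Ys X≡ chain refl refl)
        (λ {a} flag → composition-cong (proj₁ (proj₂ (proj₂ (flag⇒chain a X Ys flag))))
                                       (proj₂ (proj₂ (proj₂ (flag⇒chain a X Ys flag))))))
      (sym (trans (ℕₚ.*-identityˡ _) (ℕₚ.*-identityˡ _)))
      where
      -- The step sizes do form a composition: strict inclusions make them positive, and a top flat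
      -- of full rank makes them add up to `n`.
      a* : Composition n r
      a* = composition ∣ X ∣ (steps X Ys) (steps-positive X Ys chain)
        (steps-total X Ys (subst IsFlat (sym X≡) (cl-flat ⊥))
          (trans (cong (λ z → rk z + r) X≡) (trans (cong (_+ r) (trans (rk-cl ⊥) rk-⊥)) (sym rank≡r))) chain)

  -- At the start nothing is placed, so the unplaced elements of the bottom flat are all of it and
  -- the parameter of `fillings` is the part of index 0.
  ∑-ν-fillings : rank ≡ r → (s : Sequence n r) →
    ∑ (compositions n r) (λ a → ν M a * fillings (Composition.first a) (Composition.rest a) s)
      ≡ orderings ⊥ s
  ∑-ν-fillings rank≡r s = trans (∑-ν rank≡r (λ d v → fillings d v s)) (sym (trans
    (orderings≡∑-chains ⊥ s)
    (cong (λ m → ∑-chains (cl ⊥) (λ v → fillings (∣ cl ⊥ ∣ ∸ m) v s)) (∣⊥∣≡0 n))))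

-- Subsets as initial segments of orderings

module Initial {n : ℕ} (M : Matroid n) {c ℓ : Level} (S : CommutativeSemiring c ℓ) where
  open Closure M
  open Flags M using (stalls?; climbs?; orderings)
  open CommutativeSemiring S hiding (zero)
  open Sums S
  open Cast S
  open import Relation.Binary.Reasoning.Setoid setoid

  extensions? : ∀ (p : Subset n) m q → Dec (p ⊆ q × ∣ q ∣ ≡ ∣ p ∣ ℕ.+ m)
  extensions? p m q = (p ⊆? q) ×-dec (∣ q ∣ ℕ.≟ ∣ p ∣ ℕ.+ m)

  ∑-∈∖ˢ : ∀ {p q : Subset n} → p ⊆ q →
    ∑ (allFin n) (λ e → χ ((e ∈? q) ×-dec ¬? (e ∈? p))) ≈ ι (∣ q ∣ ℕ.∸ ∣ p ∣)
  ∑-∈∖ˢ {p} {q} p⊆q = begin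
    ∑ (allFin n) (λ e → χ ((e ∈? q) ×-dec ¬? (e ∈? p)))
      ≈⟨ ∑-cong (allFin n) (λ e → ι-χ ((e ∈? q) ×-dec ¬? (e ∈? p))) ⟨
    ∑ (allFin n) (λ e → ι (Σℕ.χ ((e ∈? q) ×-dec ¬? (e ∈? p))))
      ≈⟨ ι-∑ (allFin n) _ ⟨
    ι (Σℕ.∑ (allFin n) (λ e → Σℕ.χ ((e ∈? q) ×-dec ¬? (e ∈? p))))
      ≡⟨ ≡.cong ι (∑-∈∖ {p = p} p⊆q) ⟩
    ι (∣ q ∣ ℕ.∸ ∣ p ∣) ∎

  -- Shared by both bits: the choice of the first element is moved outside the sum over the
  -- remaining bits, where the inductive value `V` applies.
  ∑-orderings-next : ∀ {P : Fin n → Set} (P? : ∀ e → Dec (P e)) p k l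
    (g : Sequence k l → Carrier) (V : Subset n → Carrier) →
    (∀ e → P e → ∑ (sequences k l) (λ s → ι (orderings (p ∪ ⁅ e ⁆) s) * g s) ≈ V (p ∪ ⁅ e ⁆)) →
    ∑ (sequences k l) (λ s → ι (Σℕ.∑ (allFin n) λ e → Σℕ.χ (P? e) ℕ.* orderings (p ∪ ⁅ e ⁆) s) * g s)
      ≈ ∑ (allFin n) (λ e → χ (P? e) * V (p ∪ ⁅ e ⁆))
  ∑-orderings-next P? p k l g V next = begin
    ∑ (sequences k l) (λ s → ι (Σℕ.∑ (allFin n) λ e → Σℕ.χ (P? e) ℕ.* orderings (p ∪ ⁅ e ⁆) s) * g s)
      ≈⟨ ∑-cong (sequences k l) (λ s → trans (*-congʳ (ι-∑ (allFin n) _))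
           (trans (sym (∑-*ʳ (allFin n) _ (g s)))
             (∑-cong (allFin n) λ e → trans
               (*-congʳ (trans (ι-* (Σℕ.χ (P? e)) _) (*-congʳ (ι-χ (P? e)))))
               (*-assoc _ _ _)))) ⟩
    ∑ (sequences k l) (λ s → ∑ (allFin n) λ e → χ (P? e) * (ι (orderings (p ∪ ⁅ e ⁆) s) * g s))
      ≈⟨ ∑-swap (sequences k l) (allFin n) _ ⟩
    ∑ (allFin n) (λ e → ∑ (sequences k l) λ s → χ (P? e) * (ι (orderings (p ∪ ⁅ e ⁆) s) * g s))
      ≈⟨ ∑-cong (allFin n) (λ e → trans (∑-*ˡ (sequences k l) (χ (P? e)) _)
           (χ-*-cong (P? e) (next e))) ⟩
    ∑ (allFin n) (λ e → χ (P? e) * V (p ∪ ⁅ e ⁆)) ∎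

  χ-stalls+climbs : ∀ p e → χ (stalls? p e) + χ (climbs? p e) ≈ χ (¬? (e ∈? p))
  χ-stalls+climbs p e = χ-+ (stalls? p e) (climbs? p e) (¬? (e ∈? p)) proj₁ proj₁
    (λ { (_ , stall) (_ , climb) → ℕₚ.1+n≢n (≡.trans (≡.sym climb) stall) })
    stall-or-climb
    where
    stall-or-climb : e ∉ p → (e ∉ p × rk (p ∪ ⁅ e ⁆) ≡ rk p) ⊎ (e ∉ p × rk (p ∪ ⁅ e ⁆) ≡ suc (rk p))
    stall-or-climb e∉ with rk (p ∪ ⁅ e ⁆) ℕ.≟ rk p
    ... | yes eq = inj₁ (e∉ , eq)
    ... | no ≢   = inj₂ (e∉ ,
      ℕₚ.≤-antisym (rk-insert-≤ p e) (ℕₚ.≤∧≢⇒< (rk-insert-≥ p e) (λ eq → ≢ (≡.sym eq))))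

  -- Conditions on the first element adjoined; the statistic g of a bit sequence
  -- started at rank ρ becomes the statistic h of the remaining bits.
  ∑-orderings-suc : ∀ p k l
    (g : ∀ {l} → ℕ → Sequence (suc k) l → Carrier) (h : ∀ {l} → ℕ → Sequence k l → Carrier) →
    (∀ {l} ρ (s : Sequence k l) → g ρ (0∷ s) ≈ h ρ s) →
    (∀ {l} ρ (s : Sequence k l) → g ρ (1∷ s) ≈ h (suc ρ) s) →
    rk p ℕ.+ l ≡ rank → (V : Subset n → Carrier) →
    (∀ e l → e ∉ p → rk (p ∪ ⁅ e ⁆) ℕ.+ l ≡ rank →
      ∑ (sequences k l) (λ s → ι (orderings (p ∪ ⁅ e ⁆) s) * h (rk (p ∪ ⁅ e ⁆)) s) ≈ V (p ∪ ⁅ e ⁆)) →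
    ∑ (sequences (suc k) l) (λ s → ι (orderings p s) * g (rk p) s)
      ≈ ∑ (allFin n) (λ e → χ (¬? (e ∈? p)) * V (p ∪ ⁅ e ⁆))
  ∑-orderings-suc p k l g h g≈h₀ g≈h₁ rk+l V next = split l rk+l
    where
    stall-part : ∀ l → rk p ℕ.+ l ≡ rank →
      ∑ (sequences k l) (λ s → ι (orderings p (0∷ s)) * g (rk p) (0∷ s))
        ≈ ∑ (allFin n) (λ e → χ (stalls? p e) * V (p ∪ ⁅ e ⁆))
    stall-part l eq = ∑-orderings-next (stalls? p) p k l (λ s → g (rk p) (0∷ s)) V
      λ { e (e∉ , stall) → trans
        (∑-cong (sequences k l) λ s → *-congˡ (trans (g≈h₀ (rk p) s)
          (reflexive (≡.cong (λ ρ → h ρ s) (≡.sym stall)))))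
        (next e l e∉ (≡.trans (≡.cong (ℕ._+ l) stall) eq)) }

    climb-part : ∀ l → rk p ℕ.+ suc l ≡ rank →
      ∑ (sequences k l) (λ s → ι (orderings p (1∷ s)) * g (rk p) (1∷ s))
        ≈ ∑ (allFin n) (λ e → χ (climbs? p e) * V (p ∪ ⁅ e ⁆))
    climb-part l eq = ∑-orderings-next (climbs? p) p k l (λ s → g (rk p) (1∷ s)) V
      λ { e (e∉ , climb) → trans
        (∑-cong (sequences k l) λ s → *-congˡ (trans (g≈h₁ (rk p) s)
          (reflexive (≡.cong (λ ρ → h ρ s) (≡.sym climb)))))
        (next e l e∉ (≡.trans (≡.cong (ℕ._+ l) climb) (≡.trans (≡.sym (ℕₚ.+-suc (rk p) l)) eq))) }

    split : ∀ l → rk p ℕ.+ l ≡ rank →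
      ∑ (sequences (suc k) l) (λ s → ι (orderings p s) * g (rk p) s)
        ≈ ∑ (allFin n) (λ e → χ (¬? (e ∈? p)) * V (p ∪ ⁅ e ⁆))
    -- With no ones left the rank of `p` is already full, so every element outside `p` stalls and
    -- only sequences starting with 0 occur.
    split zero eq = trans (reflexive (∑-map 0∷_ (sequences k zero))) (trans (stall-part zero eq)
      (∑-cong (allFin n) λ e → *-congʳ (reflexive (χ-⇔ (stalls? p e) (¬? (e ∈? p)) proj₁
        λ e∉ → e∉ , ℕₚ.≤-antisym
          (≡.subst (rk (p ∪ ⁅ e ⁆) ≤_) (≡.trans (≡.sym eq) (ℕₚ.+-identityʳ (rk p)))
            (rk-mono (⊆⊤ {p = p ∪ ⁅ e ⁆})))
          (rk-insert-≥ p e)))))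
    split (suc l) eq = begin
      ∑ (sequences (suc k) (suc l)) (λ s → ι (orderings p s) * g (rk p) s)
        ≈⟨ ∑-++ (List.map 0∷_ (sequences k (suc l))) _ ⟩
      ∑ (List.map 0∷_ (sequences k (suc l))) (λ s → ι (orderings p s) * g (rk p) s)
        + ∑ (List.map 1∷_ (sequences k l)) (λ s → ι (orderings p s) * g (rk p) s)
        ≡⟨ ≡.cong₂ _+_ (∑-map 0∷_ (sequences k (suc l))) (∑-map 1∷_ (sequences k l)) ⟩
      _ ≈⟨ +-cong (stall-part (suc l) eq) (climb-part l eq) ⟩
      ∑ (allFin n) (λ e → χ (stalls? p e) * V (p ∪ ⁅ e ⁆))
        + ∑ (allFin n) (λ e → χ (climbs? p e) * V (p ∪ ⁅ e ⁆))
        ≈⟨ ∑-+ (allFin n) _ _ ⟨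
      ∑ (allFin n) (λ e → χ (stalls? p e) * V (p ∪ ⁅ e ⁆) + χ (climbs? p e) * V (p ∪ ⁅ e ⁆))
        ≈⟨ ∑-cong (allFin n) (λ e → trans (sym (distribʳ _ _ _)) (*-congʳ (χ-stalls+climbs p e))) ⟩
      ∑ (allFin n) (λ e → χ (¬? (e ∈? p)) * V (p ∪ ⁅ e ⁆)) ∎

  insert-size : ∀ {p : Subset n} {e k} → e ∉ p → ∣ p ∣ ℕ.+ suc k ≡ n → ∣ p ∪ ⁅ e ⁆ ∣ ℕ.+ k ≡ n
  insert-size {p} {e} {k} e∉ eq =
    ≡.trans (≡.cong (ℕ._+ k) (∣p∪⁅x⁆∣ p e e∉)) (≡.trans (≡.sym (ℕₚ.+-suc ∣ p ∣ k)) eq)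

  -- Each ordering of the remaining `k` elements has exactly one bit sequence, so the matroid drops
  -- out of the total. The factor `1#` is the constant statistic, in the shape that
  -- `∑-orderings-suc` expects.
  ∑-orderings : ∀ k p l → ∣ p ∣ ℕ.+ k ≡ n → rk p ℕ.+ l ≡ rank →
    ∑ (sequences k l) (λ s → ι (orderings p s) * 1#) ≈ ι (k !)
  ∑-orderings zero p (suc l) size rk+l =
    -- There is no sequence of length 0 with a one, while `0 !` is 1; but `p` is the whole set, so
    -- its rank is already full.
    contradiction (≡.trans (≡.cong (λ q → rk q ℕ.+ suc l) (≡.sym p≡⊤)) rk+l) (ℕₚ.m+1+n≢m rank)
    where
    p≡⊤ : p ≡ ⊤
    p≡⊤ = ∣p∣≡n⇒p≡⊤ (≡.trans (≡.sym (ℕₚ.+-identityʳ ∣ p ∣)) size)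
  ∑-orderings zero p zero size rk+l = trans (+-identityʳ _) (*-identityʳ _)
  ∑-orderings (suc k) p l size rk+l = begin
    ∑ (sequences (suc k) l) (λ s → ι (orderings p s) * 1#)
      ≈⟨ ∑-orderings-suc p k l (λ _ _ → 1#) (λ _ _ → 1#) (λ _ _ → refl) (λ _ _ → refl) rk+l (λ _ → ι (k !))
           (λ e l e∉ eq → ∑-orderings k (p ∪ ⁅ e ⁆) l (insert-size e∉ size) eq) ⟩
    ∑ (allFin n) (λ e → χ (¬? (e ∈? p)) * ι (k !))
      ≈⟨ ∑-*ʳ (allFin n) _ _ ⟩
    ∑ (allFin n) (λ e → χ (¬? (e ∈? p))) * ι (k !)
      ≈⟨ *-congʳ (∑-cong (allFin n) λ e → reflexive (χ-⇔ (¬? (e ∈? p)) ((e ∈? ⊤) ×-dec ¬? (e ∈? p))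
           (λ e∉ → ∈⊤ , e∉) proj₂)) ⟩
    ∑ (allFin n) (λ e → χ ((e ∈? ⊤) ×-dec ¬? (e ∈? p))) * ι (k !)
      ≈⟨ *-congʳ (∑-∈∖ˢ {p} (⊆⊤ {p = p})) ⟩
    ι (∣ ⊤ {n} ∣ ℕ.∸ ∣ p ∣) * ι (k !)
      ≡⟨ ≡.cong (λ m → ι m * ι (k !)) (≡.trans (≡.cong (ℕ._∸ ∣ p ∣) (≡.trans (∣⊤∣≡n n) (≡.sym size)))
           (ℕₚ.m+n∸m≡n ∣ p ∣ (suc k))) ⟩
    ι (suc k) * ι (k !)
      ≈⟨ ι-* (suc k) (k !) ⟨
    ι (suc k !) ∎

  -- Induction on `m`. A superset `q` of `p` with `suc m` further elements is reached from each of
  -- these as the first one adjoined, which supplies the new factor of the factorial; for `m` equal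
  -- to 0 the other `k` elements come in any order. After `m` bits the rank reached, `rk p` plus the
  -- ones seen, is the rank of `q`.
  ∑-orderings-initial : (F : ℕ → Carrier) → ∀ m k p l → ∣ p ∣ ℕ.+ (m ℕ.+ k) ≡ n → rk p ℕ.+ l ≡ rank →
    ∑ (sequences (m ℕ.+ k) l) (λ s → ι (orderings p s) * F (rk p ℕ.+ ones m s))
      ≈ ι (m ! ℕ.* k !) * ∑ (subsets n) (λ q → χ (extensions? p m q) * F (rk q))
  ∑-orderings-initial F zero k p l size rk+l = begin
    ∑ (sequences k l) (λ s → ι (orderings p s) * F (rk p ℕ.+ 0))
      ≈⟨ ∑-cong (sequences k l) (λ s → *-cong (sym (*-identityʳ _)) (reflexive (≡.cong F (ℕₚ.+-identityʳ (rk p))))) ⟩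
    ∑ (sequences k l) (λ s → ι (orderings p s) * 1# * F (rk p))
      ≈⟨ ∑-*ʳ (sequences k l) _ _ ⟩
    ∑ (sequences k l) (λ s → ι (orderings p s) * 1#) * F (rk p)
      ≈⟨ *-congʳ (∑-orderings k p l size rk+l) ⟩
    ι (k !) * F (rk p)
      ≈⟨ *-cong (reflexive (≡.cong ι (≡.sym (ℕₚ.*-identityˡ (k !)))))
          (sym (∑-χ-unique (extensions? p 0) (subsets-unique n) (subsets-complete p)
            ((λ {x} x∈ → x∈) , ≡.sym (ℕₚ.+-identityʳ ∣ p ∣))
            (λ { (p⊆q , eq) → ⊆∧∣∣≡⇒≡ p⊆q (≡.trans eq (ℕₚ.+-identityʳ ∣ p ∣)) }))) ⟩
    ι (1 ℕ.* k !) * ∑ (subsets n) (λ q → χ (extensions? p 0 q) * F (rk q)) ∎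
  ∑-orderings-initial F (suc m) k p l size rk+l = begin
    ∑ (sequences (suc (m ℕ.+ k)) l) (λ s → ι (orderings p s) * F (rk p ℕ.+ ones (suc m) s))
      ≈⟨ ∑-orderings-suc p (m ℕ.+ k) l (λ ρ s → F (ρ ℕ.+ ones (suc m) s)) (λ ρ s → F (ρ ℕ.+ ones m s))
           (λ _ _ → refl) (λ ρ s → reflexive (≡.cong F (ℕₚ.+-suc ρ (ones m s)))) rk+l
           (λ p′ → scale * ∑ (subsets n) (λ q → χ (extensions? p′ m q) * F (rk q)))
           (λ e l e∉ eq → ∑-orderings-initial F m k (p ∪ ⁅ e ⁆) l (insert-size e∉ size) eq) ⟩
    ∑ (allFin n) (λ e → χ (¬? (e ∈? p)) * (scale * ∑ (subsets n) (λ q → χ (extensions? (p ∪ ⁅ e ⁆) m q) * F (rk q))))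
      ≈⟨ ∑-cong (allFin n) (λ e → trans (x∙yz≈y∙xz _ scale _) (*-congˡ (sym (∑-*ˡ (subsets n) _ _)))) ⟩
    ∑ (allFin n) (λ e → scale * ∑ (subsets n) (λ q → χ (¬? (e ∈? p)) * (χ (extensions? (p ∪ ⁅ e ⁆) m q) * F (rk q))))
      ≈⟨ ∑-*ˡ (allFin n) scale _ ⟩
    scale * ∑ (allFin n) (λ e → ∑ (subsets n) (λ q → χ (¬? (e ∈? p)) * (χ (extensions? (p ∪ ⁅ e ⁆) m q) * F (rk q))))
      ≈⟨ *-congˡ (∑-swap (allFin n) (subsets n) _) ⟩
    scale * ∑ (subsets n) (λ q → ∑ (allFin n) (λ e → χ (¬? (e ∈? p)) * (χ (extensions? (p ∪ ⁅ e ⁆) m q) * F (rk q))))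
      ≈⟨ *-congˡ (∑-cong (subsets n) multiplicity) ⟩
    scale * ∑ (subsets n) (λ q → ι (suc m) * (χ (extensions? p (suc m) q) * F (rk q)))
      ≈⟨ *-congˡ (∑-*ˡ (subsets n) (ι (suc m)) _) ⟩
    scale * (ι (suc m) * ∑ (subsets n) (λ q → χ (extensions? p (suc m) q) * F (rk q)))
      ≈⟨ *-assoc scale (ι (suc m)) _ ⟨
    scale * ι (suc m) * ∑ (subsets n) (λ q → χ (extensions? p (suc m) q) * F (rk q))
      ≈⟨ *-congʳ (trans (*-comm scale _) (trans (sym (ι-* (suc m) (m ! ℕ.* k !)))
           (reflexive (≡.cong ι (≡.sym (ℕₚ.*-assoc (suc m) (m !) (k !))))))) ⟩
    ι (suc m ! ℕ.* k !) * ∑ (subsets n) (λ q → χ (extensions? p (suc m) q) * F (rk q)) ∎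
    where
    open import Algebra.Properties.CommutativeSemigroup *-commutativeSemigroup using (x∙yz≈y∙xz)

    scale : Carrier
    scale = ι (m ! ℕ.* k !)

    size-suc : ∀ {e} → e ∉ p → ∣ p ∪ ⁅ e ⁆ ∣ ℕ.+ m ≡ ∣ p ∣ ℕ.+ suc m
    size-suc {e} e∉ = ≡.trans (≡.cong (ℕ._+ m) (∣p∪⁅x⁆∣ p e e∉)) (≡.sym (ℕₚ.+-suc ∣ p ∣ m))

    insert⁺ : ∀ {e q} → e ∉ p × p ∪ ⁅ e ⁆ ⊆ q × ∣ q ∣ ≡ ∣ p ∪ ⁅ e ⁆ ∣ ℕ.+ m →
              (p ⊆ q × ∣ q ∣ ≡ ∣ p ∣ ℕ.+ suc m) × e ∈ q × e ∉ p
    insert⁺ {e} (e∉ , ⊆q , eq) =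
      ((λ {x} x∈ → ⊆q (p⊆p∪q {p = p} _ x∈)) , ≡.trans eq (size-suc e∉)) , ⊆q (x∈p∪⁅x⁆ p e) , e∉

    insert⁻ : ∀ {e q} → (p ⊆ q × ∣ q ∣ ≡ ∣ p ∣ ℕ.+ suc m) × e ∈ q × e ∉ p →
              e ∉ p × p ∪ ⁅ e ⁆ ⊆ q × ∣ q ∣ ≡ ∣ p ∪ ⁅ e ⁆ ∣ ℕ.+ m
    insert⁻ {e} {q} ((p⊆q , eq) , e∈q , e∉) =
      e∉ , (λ {x} → p∪⁅x⁆⊆q {p = p} {q} {e} p⊆q e∈q {x}) , ≡.trans eq (≡.sym (size-suc e∉))

    multiplicity : ∀ q →
      ∑ (allFin n) (λ e → χ (¬? (e ∈? p)) * (χ (extensions? (p ∪ ⁅ e ⁆) m q) * F (rk q)))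
        ≈ ι (suc m) * (χ (extensions? p (suc m) q) * F (rk q))
    multiplicity q = begin
      ∑ (allFin n) (λ e → χ (¬? (e ∈? p)) * (χ (extensions? (p ∪ ⁅ e ⁆) m q) * F (rk q)))
        ≈⟨ ∑-cong (allFin n) (λ e → trans (sym (*-assoc _ _ _)) (*-congʳ (begin
             χ (¬? (e ∈? p)) * χ (extensions? (p ∪ ⁅ e ⁆) m q)
               ≈⟨ χ-× (¬? (e ∈? p)) (extensions? (p ∪ ⁅ e ⁆) m q) ⟨
             χ (¬? (e ∈? p) ×-dec extensions? (p ∪ ⁅ e ⁆) m q)
               ≡⟨ χ-⇔ (¬? (e ∈? p) ×-dec extensions? (p ∪ ⁅ e ⁆) m q)
                    (extensions? p (suc m) q ×-dec ((e ∈? q) ×-dec ¬? (e ∈? p)))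
                    insert⁺ insert⁻ ⟩
             χ (extensions? p (suc m) q ×-dec ((e ∈? q) ×-dec ¬? (e ∈? p)))
               ≈⟨ χ-× (extensions? p (suc m) q) ((e ∈? q) ×-dec ¬? (e ∈? p)) ⟩
             χ (extensions? p (suc m) q) * χ ((e ∈? q) ×-dec ¬? (e ∈? p)) ∎))) ⟩
      ∑ (allFin n) (λ e → χ (extensions? p (suc m) q) * χ ((e ∈? q) ×-dec ¬? (e ∈? p)) * F (rk q))
        ≈⟨ trans (∑-*ʳ (allFin n) _ _) (*-congʳ (∑-*ˡ (allFin n) _ _)) ⟩
      χ (extensions? p (suc m) q) * ∑ (allFin n) (λ e → χ ((e ∈? q) ×-dec ¬? (e ∈? p))) * F (rk q)
        ≈⟨ *-congʳ (χ-*-cong (extensions? p (suc m) q) λ { (p⊆q , eq) → trans (∑-∈∖ˢ {p} p⊆q)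
             (reflexive (≡.cong ι (≡.trans (≡.cong (ℕ._∸ ∣ p ∣) eq) (ℕₚ.m+n∸m≡n ∣ p ∣ (suc m))))) }) ⟩
      χ (extensions? p (suc m) q) * ι (suc m) * F (rk q)
        ≈⟨ trans (*-congʳ (*-comm _ _)) (*-assoc _ _ _) ⟩
      ι (suc m) * (χ (extensions? p (suc m) q) * F (rk q)) ∎

-- The coefficients of γ as numbers of fillings

module GammaCoefficient where
  open ≡ using (refl; sym; trans; cong; cong₂; subst)
  open import Data.Nat using (_+_; _*_)
  open import Data.Integer using (+_; 1ℤ; 0ℤ)

  module Σℤ = Sums ℤₚ.+-*-commutativeSemiring

  sumBelow : (Fin n → ℤ) → Fin n → ℤ
  sumBelow {n} c j = fold ℤ.+-0-rawMonoid (filter (Fin._<? j) (allFin n)) c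

  sumBelow-zero : (c : Fin (suc n) → ℤ) → sumBelow c Fin.zero ≡ 0ℤ
  sumBelow-zero {n} c = trans (Σℤ.∑-filter {f = c} (Fin._<? Fin.zero {n}) (allFin (suc n)))
    (Σℤ.∑-χ-none {f = c} (Fin._<? Fin.zero {n}) (AllL.universal (λ _ ()) (allFin (suc n))))

  sumBelow-suc : (c : Fin (suc n) → ℤ) (j : Fin n) →
    sumBelow c (Fin.suc j) ≡ c Fin.zero ℤ.+ sumBelow (c ∘ Fin.suc) j
  sumBelow-suc {n} c j = begin
    sumBelow c (Fin.suc j)
      ≡⟨ Σℤ.∑-filter {f = c} (Fin._<? Fin.suc j) (allFin (suc n)) ⟩
    Σℤ.∑ (allFin (suc n)) (λ i → Σℤ.χ (i Fin.<? Fin.suc j) ℤ.* c i)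
      ≡⟨ fold-allFin-suc ℤ.+-0-rawMonoid (λ i → Σℤ.χ (i Fin.<? Fin.suc j) ℤ.* c i) ⟩
    Σℤ.χ (Fin.zero {n} Fin.<? Fin.suc j) ℤ.* c Fin.zero
      ℤ.+ Σℤ.∑ (allFin n) (λ i → Σℤ.χ (Fin.suc i Fin.<? Fin.suc j) ℤ.* c (Fin.suc i))
      ≡⟨ cong₂ ℤ._+_
           (trans (cong (ℤ._* c Fin.zero) (Σℤ.χ-true (Fin.zero {n} Fin.<? Fin.suc j) (s≤s z≤n))) (ℤₚ.*-identityˡ _))
           (Σℤ.∑-cong (allFin n) λ i → cong (ℤ._* c (Fin.suc i))
             (Σℤ.χ-⇔ (Fin.suc i Fin.<? Fin.suc j) (i Fin.<? j) ℕₚ.≤-pred s≤s)) ⟩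
    c Fin.zero ℤ.+ Σℤ.∑ (allFin n) (λ i → Σℤ.χ (i Fin.<? j) ℤ.* c (Fin.suc i))
      ≡⟨ cong (λ z → c Fin.zero ℤ.+ z) (Σℤ.∑-filter {f = c ∘ Fin.suc} (Fin._<? j) (allFin n)) ⟨
    c Fin.zero ℤ.+ sumBelow (c ∘ Fin.suc) j ∎
    where open ≡-Reasoning

  -- The product over j ≥ 1 in γ-coefficient; E is the excess accumulated so far.
  γ-product : ℤ → Vec ℕ l → Vec ℕ l → ℤ
  γ-product E []       []       = 1ℤ
  γ-product E (a ∷ as) (b ∷ bs) =
    + a ℤ.* (+ a ℤ.- 1ℤ ℤ.+ E) ↓ (b ℕ.∸ 1) ℤ.* γ-product (E ℤ.+ (+ a ℤ.- + b)) as bs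

  module _ {l : ℕ} (as bs : Vec ℕ l) where
    difference : Fin l → ℤ
    difference i = + lookup as i ℤ.- + lookup bs i

    γ-factor : ℤ → Fin l → ℤ
    γ-factor E j = + lookup as j ℤ.* (+ lookup as j ℤ.- 1ℤ ℤ.+ E) ↓ (lookup bs j ℕ.∸ 1)

  -- Passing to the tail moves the first difference out of every inner sum, and `E` collects what
  -- has been moved; hence the general `E`.
  γ-product≡fold : ∀ E (as bs : Vec ℕ l) →
    fold ℤ.*-1-rawMonoid (allFin l) (λ j → γ-factor as bs (E ℤ.+ sumBelow (difference as bs) j) j)
      ≡ γ-product E as bs
  γ-product≡fold E []       []       = refl
  γ-product≡fold E (a ∷ as) (b ∷ bs) = trans
    (fold-allFin-suc ℤ.*-1-rawMonoid λ j →
      γ-factor (a ∷ as) (b ∷ bs) (E ℤ.+ sumBelow (difference (a ∷ as) (b ∷ bs)) j) j)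
    (cong₂ ℤ._*_
      (cong (λ e → γ-factor (a ∷ as) (b ∷ bs) e Fin.zero)
        (trans (cong (λ z → E ℤ.+ z) (sumBelow-zero (difference (a ∷ as) (b ∷ bs)))) (ℤₚ.+-identityʳ E)))
      (trans
        (fold-cong ℤ.*-1-rawMonoid (allFin _) λ j → cong (λ e → γ-factor as bs e j)
          (trans (cong (λ z → E ℤ.+ z) (sumBelow-suc (difference (a ∷ as) (b ∷ bs)) j)) (sym (ℤₚ.+-assoc E _ _))))
        (γ-product≡fold (E ℤ.+ (+ a ℤ.- + b)) as bs)))

  γ-coefficient≡ : (a b : Composition n r) → let open Composition in
    γ-coefficient a b ≡ (+ first a) ↓ first b ℤ.* γ-product (+ first a ℤ.- + first b) (rest a) (rest b)
  γ-coefficient≡ {r = r} a b = cong ((+ first a) ↓ first b ℤ.*_) (trans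
    (fold-cong ℤ.*-1-rawMonoid (allFin r) λ j → cong (λ e → γ-factor (rest a) (rest b) e j)
      (sumBelow-suc (difference (first a ∷ rest a) (first b ∷ rest b)) j))
    (γ-product≡fold (+ first a ℤ.- + first b) (rest a) (rest b)))
    where open Composition

  sumFirst : Vec ℕ l → ℕ → ℕ
  sumFirst as       zero    = 0
  sumFirst []       (suc w) = 0
  sumFirst (a ∷ as) (suc w) = a + sumFirst as w

  -- When every prefix of length j satisfies this, an ordering following s never
  -- runs out of elements of the current flat.
  Feasible : ℕ → Vec ℕ l → Sequence k l → Set
  Feasible {k = k} d as s = ∀ j → j ≤ k → j ≤ d + sumFirst as (ones j s)

  -- The first prefix to ask for more elements than are available ends in a bit 0 met with `d` equal
  -- to 0, which contributes the factor 0.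
  fillings-feasible : ∀ d (as : Vec ℕ l) → All (1 ≤_) as → (s : Sequence k l) →
    fillings d as s ≡ 0 ⊎ Feasible d as s
  fillings-feasible d       as ps [] = inj₂ λ { zero _ → z≤n }
  fillings-feasible zero    as ps (0∷ s) = inj₁ refl
  fillings-feasible (suc d) as ps (0∷ s) with fillings-feasible d as ps s
  ... | inj₁ eq  = inj₁ (trans (cong (suc d *_) eq) (ℕₚ.*-zeroʳ (suc d)))
  ... | inj₂ fea = inj₂ λ { zero _ → z≤n ; (suc j) (s≤s j≤k) → s≤s (fea j j≤k) }
  fillings-feasible d (suc a ∷ as) (_ ∷ ps) (1∷ s) with fillings-feasible (pred (d + suc a)) as ps s
  ... | inj₁ eq  = inj₁ (trans (cong (suc a *_) eq) (ℕₚ.*-zeroʳ (suc a)))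
  ... | inj₂ fea = inj₂ λ
    { zero    _         → z≤n
    ; (suc j) (s≤s j≤k) → subst (suc j ≤_) (trans
        (cong (λ m → suc (pred m + sumFirst as (ones j s))) (ℕₚ.+-suc d a))
        (trans (cong (_+ sumFirst as (ones j s)) (sym (ℕₚ.+-suc d a)))
               (ℕₚ.+-assoc d (suc a) _)))
        (s≤s (fea j j≤k)) }

  -- The leading `k` zeros produce the factors of the falling factorial of `d`, after which `d - k`
  -- elements are carried over as the excess. Feasibility excludes a zero met with nothing left, so
  -- `pred d` is always the integer `d - 1`.
  fillings-blocks : ∀ d (as : Vec ℕ l) → All (1 ≤_) as → ∀ k (bs : Vec ℕ l) (ps : All (1 ≤_) bs) →
    Feasible d as (zeros k (blocks bs ps)) →
    + fillings d as (zeros k (blocks bs ps)) ≡ (+ d) ↓ k ℤ.* γ-product (+ d ℤ.- + k) as bs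
  fillings-blocks d [] _ zero [] [] fea = refl
  fillings-blocks d (zero ∷ as) (() ∷ _)
  fillings-blocks d (suc a ∷ as) (s≤s _ ∷ qs) zero (suc k ∷ bs) (_ ∷ ps) fea = begin
    + (suc a * fillings (pred (d + suc a)) as s)
      ≡⟨ ℤₚ.pos-* (suc a) _ ⟩
    + suc a ℤ.* + fillings (pred (d + suc a)) as s
      ≡⟨ cong (λ m → + suc a ℤ.* + fillings (pred m) as s) (ℕₚ.+-suc d a) ⟩
    + suc a ℤ.* + fillings (d + a) as s
      ≡⟨ cong (+ suc a ℤ.*_) (fillings-blocks (d + a) as qs k bs ps feasible) ⟩
    + suc a ℤ.* ((+ (d + a)) ↓ k ℤ.* γ-product (+ (d + a) ℤ.- + k) as bs)
      ≡⟨ ℤₚ.*-assoc (+ suc a) ((+ (d + a)) ↓ k) (γ-product (+ (d + a) ℤ.- + k) as bs) ⟨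
    + suc a ℤ.* (+ (d + a)) ↓ k ℤ.* γ-product (+ (d + a) ℤ.- + k) as bs
      -- The 1 opening the block uses up one of the `suc a` new elements, which accounts for the
      -- `- 1` in the falling factorial of γ; the `d` left over from earlier blocks are its excess.
      ≡⟨ cong₂ (λ e e′ → + suc a ℤ.* e ↓ k ℤ.* γ-product e′ as bs) top-eq excess-eq ⟩
    + suc a ℤ.* (+ suc a ℤ.- 1ℤ ℤ.+ (+ d ℤ.- 0ℤ)) ↓ k
      ℤ.* γ-product ((+ d ℤ.- 0ℤ) ℤ.+ (+ suc a ℤ.- + suc k)) as bs
      ≡⟨ ℤₚ.*-identityˡ _ ⟨
    1ℤ ℤ.* γ-product (+ d ℤ.- 0ℤ) (suc a ∷ as) (suc k ∷ bs) ∎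
    where
    open ≡-Reasoning
    open +-*-Solver

    s = zeros k (blocks bs ps)

    top-eq : + (d + a) ≡ + suc a ℤ.- 1ℤ ℤ.+ (+ d ℤ.- 0ℤ)
    top-eq = trans (ℤₚ.pos-+ d a)
      (solve 2 (λ x y → x :+ y := con 1ℤ :+ y :- con 1ℤ :+ (x :- con 0ℤ)) refl (+ d) (+ a))

    excess-eq : + (d + a) ℤ.- + k ≡ (+ d ℤ.- 0ℤ) ℤ.+ (+ suc a ℤ.- + suc k)
    excess-eq = trans (cong (ℤ._- + k) (ℤₚ.pos-+ d a))
      (solve 3 (λ x y z → x :+ y :- z := (x :- con 0ℤ) :+ ((con 1ℤ :+ y) :- (con 1ℤ :+ z))) refl (+ d) (+ a) (+ k))

    feasible : Feasible (d + a) as s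
    feasible j j≤ = ℕₚ.≤-pred (subst (suc j ≤_)
      (trans (sym (ℕₚ.+-assoc d (suc a) _)) (cong (_+ sumFirst as (ones j s)) (ℕₚ.+-suc d a)))
      (fea (suc j) (s≤s j≤)))
  fillings-blocks zero as qs (suc k) bs ps fea = contradiction (fea 1 (s≤s z≤n)) λ ()
  fillings-blocks (suc d) as qs (suc k) bs ps fea = begin
    + (suc d * fillings d as s)
      ≡⟨ ℤₚ.pos-* (suc d) _ ⟩
    + suc d ℤ.* + fillings d as s
      ≡⟨ cong (+ suc d ℤ.*_) (fillings-blocks d as qs k bs ps (λ j j≤ → ℕₚ.≤-pred (fea (suc j) (s≤s j≤)))) ⟩
    + suc d ℤ.* ((+ d) ↓ k ℤ.* γ-product (+ d ℤ.- + k) as bs)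
      ≡⟨ ℤₚ.*-assoc (+ suc d) ((+ d) ↓ k) (γ-product (+ d ℤ.- + k) as bs) ⟨
    + suc d ℤ.* (+ d) ↓ k ℤ.* γ-product (+ d ℤ.- + k) as bs
      ≡⟨ cong (λ e → + suc d ℤ.* (+ d) ↓ k ℤ.* γ-product e as bs)
           (solve 2 (λ x y → x :- y := (con 1ℤ :+ x) :- (con 1ℤ :+ y)) refl (+ d) (+ k)) ⟩
    + suc d ℤ.* (+ d) ↓ k ℤ.* γ-product (+ suc d ℤ.- + suc k) as bs ∎
    where
    open ≡-Reasoning
    open +-*-Solver
    s = zeros k (blocks bs ps)

  -- With `ones-blocks⁻`, a Galois connection: in the sequence of a composition, the 1 numbered
  -- `w + 1` stands right after the first a_0 + ... + a_w positions. It translates ⊵ into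
  -- feasibility.
  ones-blocks⁺ : ∀ a (as : Vec ℕ l) (ps : All (1 ≤_) as) j w →
    j ≤ a + sumFirst as w → ones j (zeros a (blocks as ps)) ≤ w
  ones-blocks⁺ a       as           ps       zero    w       j≤ = z≤n
  ones-blocks⁺ zero    []           []       (suc j) w       j≤ = z≤n
  ones-blocks⁺ zero    (suc a ∷ as) (_ ∷ ps) (suc j) (suc w) (s≤s j≤) = s≤s (ones-blocks⁺ a as ps j w j≤)
  ones-blocks⁺ (suc a) as           ps       (suc j) w       (s≤s j≤) = ones-blocks⁺ a as ps j w j≤

  -- The bound on `j` matters once `w` reaches the number of ones: the hypothesis on `ones` then
  -- holds for every `j`, while `sumFirst` has stopped growing.
  ones-blocks⁻ : ∀ a (as : Vec ℕ l) (ps : All (1 ≤_) as) j w → j ≤ a + Vec.sum as →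
    ones j (zeros a (blocks as ps)) ≤ w → j ≤ a + sumFirst as w
  ones-blocks⁻ a       as           ps       zero    w       j≤       _ = z≤n
  ones-blocks⁻ zero    (suc a ∷ as) (_ ∷ ps) (suc j) (suc w) (s≤s j≤) (s≤s o≤) = s≤s (ones-blocks⁻ a as ps j w j≤ o≤)
  ones-blocks⁻ (suc a) as           ps       (suc j) w       (s≤s j≤) o≤ = s≤s (ones-blocks⁻ a as ps j w j≤ o≤)

  ⊵⇒feasible : (a : Composition n r) (s : Sequence n r) → s ⊵ toSequence a →
    Feasible (Composition.first a) (Composition.rest a) s
  ⊵⇒feasible (composition a₀ as ps refl) s s⊵a j j≤n = ones-blocks⁻ a₀ as ps j (ones j s) j≤n
    (subst (λ i → ones i (zeros a₀ (blocks as ps)) ≤ ones i s) (Finₚ.toℕ-fromℕ< (s≤s j≤n))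
      (s⊵a (Fin.fromℕ< (s≤s j≤n))))

  feasible⇒⊵ : (a : Composition n r) (s : Sequence n r) →
    Feasible (Composition.first a) (Composition.rest a) s → s ⊵ toSequence a
  feasible⇒⊵ (composition a₀ as ps refl) s fea j =
    ones-blocks⁺ a₀ as ps (toℕ j) (ones (toℕ j) s) (fea (toℕ j) (Finₚ.toℕ≤pred[n] j))

  γ-coefficient≡fillings : (a b : Composition n r) → toSequence b ⊵ toSequence a →
    γ-coefficient a b ≡ + fillings (Composition.first a) (Composition.rest a) (toSequence b)
  γ-coefficient≡fillings a b@(composition b₀ bs ps refl) b⊵a = trans (γ-coefficient≡ a b)
    (sym (fillings-blocks first rest positive b₀ bs ps (⊵⇒feasible a (toSequence b) b⊵a)))
    where open Composition a

  ¬⊵⇒fillings≡0 : (a : Composition n r) (s : Sequence n r) → ¬ s ⊵ toSequence a →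
    fillings (Composition.first a) (Composition.rest a) s ≡ 0
  ¬⊵⇒fillings≡0 a s ¬s⊵a with fillings-feasible first rest positive s
    where open Composition a
  ... | inj₁ eq  = eq
  ... | inj₂ fea = contradiction (feasible⇒⊵ a s fea) ¬s⊵a

open GammaCoefficient

nCk*k!*[n∸k]!≡n! : ∀ {n k} → k ≤ n → (n C k) ℕ.* (k ! ℕ.* (n ∸ k) !) ≡ n !
nCk*k!*[n∸k]!≡n! {n} {k} k≤n = ≡.trans
  (≡.cong (ℕ._* (k ! ℕ.* (n ∸ k) !)) (nCk≡n!/k![n-k]! k≤n))
  (m/n*n≡m {{k ℕₚ.!* (n ∸ k) !≢0}} (k![n∸k]!∣n! k≤n))

-- Coefficient extraction from polynomials in two variables

module Coefficients {c ℓ : Level} (R : CommutativeRing c ℓ) where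
  open CommutativeRing R hiding (zero)
  open Sums commutativeSemiring
  import Algebra.Definitions.RawSemiring as RawSemiringDefs

  private
    module R[x]   = RawRing (polynomialRawRing rawRing)
    module R[x,y] = RawRing (polynomialRawRing (polynomialRawRing rawRing))
  open RawSemiringDefs R[x,y].rawSemiring using () renaming (_×_ to _×ᵖ_)

  coefficient-+ : ∀ p q i → coefficient rawRing (p R[x].+ q) i
                            ≈ coefficient rawRing p i + coefficient rawRing q i
  coefficient-+ []      q       i       = sym (+-identityˡ _)
  coefficient-+ (k ∷ p) []      i       = sym (+-identityʳ _)
  coefficient-+ (k ∷ p) (l ∷ q) zero    = refl
  coefficient-+ (k ∷ p) (l ∷ q) (suc i) = coefficient-+ p q i

  coefficient-* : ∀ k p i → coefficient rawRing (List.map (k *_) p) i ≈ k * coefficient rawRing p i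
  coefficient-* k []      i       = sym (zeroʳ k)
  coefficient-* k (l ∷ p) zero    = refl
  coefficient-* k (l ∷ p) (suc i) = coefficient-* k p i

  +-[] : ∀ p → p R[x].+ [] ≡ p
  +-[] []      = ≡.refl
  +-[] (k ∷ p) = ≡.refl

  outer-+ : ∀ P Q i → coefficient (polynomialRawRing rawRing) (P R[x,y].+ Q) i
            ≡ coefficient (polynomialRawRing rawRing) P i R[x].+ coefficient (polynomialRawRing rawRing) Q i
  outer-+ []      Q       i       = ≡.refl
  outer-+ (p ∷ P) []      i       = ≡.sym (+-[] _)
  outer-+ (p ∷ P) (q ∷ Q) zero    = ≡.refl
  outer-+ (p ∷ P) (q ∷ Q) (suc i) = outer-+ P Q i

  outer-map : ∀ (f : R[x].Carrier → R[x].Carrier) → f [] ≡ [] → ∀ P i →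
    coefficient (polynomialRawRing rawRing) (List.map f P) i
      ≡ f (coefficient (polynomialRawRing rawRing) P i)
  outer-map f f[] []      i       = ≡.sym f[]
  outer-map f f[] (p ∷ P) zero    = ≡.refl
  outer-map f f[] (p ∷ P) (suc i) = outer-map f f[] P i

  module _ (i j : ℕ) where
    -- The coefficient of x^j y^i, the outer list being indexed by powers of y. Equality of
    -- polynomials unfolds to equality of all these, and linearity of `φ` carries the identity over
    -- to the field.
    φ : R[x,y].Carrier → Carrier
    φ P = coefficient rawRing (coefficient (polynomialRawRing rawRing) P i) j

    φ-+ : ∀ P Q → φ (P R[x,y].+ Q) ≈ φ P + φ Q
    φ-+ P Q = trans (reflexive (≡.cong (λ p → coefficient rawRing p j) (outer-+ P Q i)))
      (coefficient-+ (coefficient (polynomialRawRing rawRing) P i) (coefficient (polynomialRawRing rawRing) Q i) j)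

    φ-• : ∀ k P → φ (List.map (List.map (k *_)) P) ≈ k * φ P
    φ-• k P = trans (reflexive (≡.cong (λ p → coefficient rawRing p j) (outer-map (List.map (k *_)) ≡.refl P i)))
      (coefficient-* k (coefficient (polynomialRawRing rawRing) P i) j)

    φ-∑ : ∀ {a} {A : Set a} (xs : List A) f → φ (fold R[x,y].+-rawMonoid xs f) ≈ ∑ xs (λ x → φ (f x))
    φ-∑ []       f = refl
    φ-∑ (x ∷ xs) f = trans (φ-+ (f x) (fold R[x,y].+-rawMonoid xs f)) (+-congˡ (φ-∑ xs f))

    φ-× : ∀ k P → φ (k ×ᵖ P) ≈ ι k * φ P
    φ-× zero    P = sym (zeroˡ _)
    φ-× (suc k) P = trans (φ-+ P (k ×ᵖ P)) (trans (+-cong (sym (*-identityˡ _)) (φ-× k P)) (sym (distribʳ _ 1# (ι k))))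

-- Applying Sp and recovering the Tutte polynomial

module Specialization {c ℓ₁ ℓ₂ : Level} (K : HeytingField c ℓ₁ ℓ₂) (char0 : CharacteristicZero K) where
  module 𝕂 = Over K char0

  R : CommutativeRing c ℓ₁
  R = HeytingCommutativeRing.commutativeRing (HeytingField.heytingCommutativeRing K)

  open CommutativeRing R hiding (zero)
  open Sums commutativeSemiring
  open Cast commutativeSemiring
  open Coefficients R using (φ; φ-•; φ-∑; φ-×)
  open import Algebra.Properties.CommutativeSemigroup *-commutativeSemigroup using (x∙yz≈y∙xz)
  open import Algebra.Properties.Ring ring using (-0#≈0#)
  open import Relation.Binary.Reasoning.Setoid setoid

  -- Only the composition of `s` contributes to the coordinate at `s`. If it lies in the range of
  -- summation, its coefficient is the number of fillings; otherwise the coordinate and that number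
  -- are both 0.
  γ≈fillings : ∀ {n r} (a : Composition n r) (s : Sequence n r) →
    𝕂.γ a s ≈ ι (fillings (Composition.first a) (Composition.rest a) s)
  γ≈fillings {n} {r} a s = begin
    𝕂.γ a s
      ≡⟨ fold-pointwise +-rawMonoid (λ g h → ∀ s → g s ≈ h s) (filter dominates? (compositions n r)) term s ⟩
    ∑ (filter dominates? (compositions n r)) (λ b → term b s)
      ≈⟨ ∑-filter dominates? (compositions n r) ⟩
    ∑ (compositions n r) (λ b → χ (dominates? b) * (𝕂.fromℤ (γ-coefficient a b) * χ (toSequence b ≟ s)))
      ≈⟨ ∑-cong (compositions n r) (λ b → trans (sym (*-assoc _ _ _)) (*-comm _ _)) ⟩
    ∑ (compositions n r) (λ b → χ (toSequence b ≟ s) * (χ (dominates? b) * 𝕂.fromℤ (γ-coefficient a b)))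
      ≈⟨ ∑-χ-unique (λ b → toSequence b ≟ s) (compositions-unique n r) (compositions-complete b*)
           (toSequence-fromSequence s)
           (λ {b} eq → ≡.trans (≡.sym (fromSequence-toSequence b)) (≡.cong fromSequence eq)) ⟩
    χ (dominates? b*) * 𝕂.fromℤ (γ-coefficient a b*)
      ≈⟨ value (dominates? b*) ⟩
    ι (fillings first rest (toSequence b*))
      ≡⟨ ≡.cong (λ t → ι (fillings first rest t)) (toSequence-fromSequence s) ⟩
    ι (fillings first rest s) ∎
    where
    open Composition a

    dominates? : (b : Composition n r) → Dec (toSequence b ⊵ toSequence a)
    dominates? b = toSequence b ⊵? toSequence a

    term : Composition n r → 𝕂.𝒢 n r
    term b = 𝕂.fromℤ (γ-coefficient a b) 𝕂.•ᴳ 𝕂.[ toSequence b ]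

    b* : Composition n r
    b* = fromSequence s

    value : (d : Dec (toSequence b* ⊵ toSequence a)) →
      χ d * 𝕂.fromℤ (γ-coefficient a b*) ≈ ι (fillings first rest (toSequence b*))
    value (yes b⊵a) = trans (*-identityˡ _) (reflexive (≡.cong 𝕂.fromℤ (γ-coefficient≡fillings a b* b⊵a)))
    value (no ¬b⊵a) = trans (zeroˡ _) (reflexive (≡.cong ι (≡.sym (¬⊵⇒fillings≡0 a (toSequence b*) ¬b⊵a))))

  1/n!*n! : ∀ n → 𝕂.1/ n ! * ι (n !) ≈ 1#
  1/n!*n! n = trans
    -- Apartness from zero yields an inverse of the difference `n ! - 0`, so the subtracted zero has
    -- to be removed.
    (*-congˡ (sym (trans (+-congˡ -0#≈0#) (+-identityʳ _))))
    (proj₁ (proj₂ (HeytingField.#⇒invertible K (char0 (n !) {{ℕₚ._!≢0 n}}))))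

  module _ {n : ℕ} (M : Matroid n) where
    open Matroid M using (rk; rank)
    open Closure M using (rk-⊥)
    open Flags M using (orderings; ∑-ν-fillings)
    open Initial M commutativeSemiring

    ∑-orderings-first : (F : ℕ → Carrier) → ∀ m → m ≤ n →
      ∑ (sequences n rank) (λ s → ι (orderings ⊥ s) * F (ones m s))
        ≈ ι (m ! ℕ.* (n ∸ m) !) * ∑ (subsets n) (λ q → χ (extensions? ⊥ m q) * F (rk q))
    ∑-orderings-first F m m≤n = recast n (ℕₚ.m+[n∸m]≡n m≤n)
      where
      -- The length of the sequences has to take the form `m + (n ∸ m)`, but `n` also indexes the
      -- matroid; so the length alone is generalized to `N` before matching.
      recast : ∀ N → m ℕ.+ (n ∸ m) ≡ N →
        ∑ (sequences N rank) (λ s → ι (orderings ⊥ s) * F (ones m s))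
          ≈ ι (m ! ℕ.* (n ∸ m) !) * ∑ (subsets n) (λ q → χ (extensions? ⊥ m q) * F (rk q))
      recast N ≡.refl = trans
        (∑-cong (sequences N rank) λ s → *-congˡ (reflexive (≡.cong (λ ρ → F (ρ ℕ.+ ones m s)) (≡.sym rk-⊥))))
        (∑-orderings-initial F m (n ∸ m) ⊥ rank
          (≡.trans (≡.cong (ℕ._+ (m ℕ.+ (n ∸ m))) (∣⊥∣≡0 n)) (ℕₚ.m+[n∸m]≡n m≤n))
          (≡.cong (ℕ._+ rank) rk-⊥))

    module _ (i j : ℕ) where
      -- The share of a set with `m` elements and rank `ρ` in one coefficient of the Tutte
      -- polynomial. The terms of Sp have the same form, as `ones m s` is the rank of the initial
      -- segment of size `m`.
      F : ℕ → ℕ → Carrier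
      F m ρ = φ i j (𝕂.monomial (rank ∸ ρ) (m ∸ ρ))

      spec : Sequence n rank → Carrier
      spec s = 𝕂.1/ n ! * ∑ (upTo (suc n)) (λ m → ι (n C m) * F m (ones m s))

      φ-Sp-basis : (s : Sequence n rank) → φ i j (𝕂.Sp-basis s) ≈ spec s
      φ-Sp-basis s = trans (φ-• i j (𝕂.1/ n !) (𝕂.∑ (upTo (suc n)) term)) (*-congˡ (trans
        (φ-∑ i j (upTo (suc n)) term)
        (∑-cong (upTo (suc n)) λ m → φ-× i j (n C m) (𝕂.monomial (rank ∸ ones m s) (m ∸ ones m s)))))
        where
        term : ℕ → 𝕂.Polynomial
        term m = (n C m) 𝕂.×ₚ 𝕂.monomial (rank ∸ ones m s) (m ∸ ones m s)

      φ-γ̄ : (a : Composition n rank) →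
        φ i j (𝕂.γ̄ a) ≈ ∑ (sequences n rank) (λ s → ι (fillings (Composition.first a) (Composition.rest a) s) * spec s)
      φ-γ̄ a = trans (φ-∑ i j (sequences n rank) (λ s → 𝕂.γ a s 𝕂.• 𝕂.Sp-basis s))
        (∑-cong (sequences n rank) λ s → trans (φ-• i j (𝕂.γ a s) (𝕂.Sp-basis s))
          (*-cong (γ≈fillings a s) (φ-Sp-basis s)))

      ∑-ν-γ̄ : φ i j (𝕂.∑ (compositions n rank) (λ a → ν M a 𝕂.×ₚ 𝕂.γ̄ a))
               ≈ ∑ (sequences n rank) (λ s → ι (orderings ⊥ s) * spec s)
      ∑-ν-γ̄ = begin
        φ i j (𝕂.∑ as (λ a → ν M a 𝕂.×ₚ 𝕂.γ̄ a))
          ≈⟨ φ-∑ i j as (λ a → ν M a 𝕂.×ₚ 𝕂.γ̄ a) ⟩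
        ∑ as (λ a → φ i j (ν M a 𝕂.×ₚ 𝕂.γ̄ a))
          ≈⟨ ∑-cong as (λ a → trans (φ-× i j (ν M a) (𝕂.γ̄ a)) (*-congˡ (φ-γ̄ a))) ⟩
        ∑ as (λ a → ι (ν M a) * ∑ ss (λ s → ι (fill a s) * spec s))
          ≈⟨ ∑-cong as (λ a → sym (∑-*ˡ ss _ _)) ⟩
        ∑ as (λ a → ∑ ss (λ s → ι (ν M a) * (ι (fill a s) * spec s)))
          ≈⟨ ∑-swap as ss _ ⟩
        ∑ ss (λ s → ∑ as (λ a → ι (ν M a) * (ι (fill a s) * spec s)))
          ≈⟨ ∑-cong ss (λ s → begin
               ∑ as (λ a → ι (ν M a) * (ι (fill a s) * spec s))
                 ≈⟨ ∑-cong as (λ a → trans (sym (*-assoc _ _ _)) (*-congʳ (sym (ι-* (ν M a) _)))) ⟩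
               ∑ as (λ a → ι (ν M a ℕ.* fill a s) * spec s)
                 ≈⟨ ∑-*ʳ as _ (spec s) ⟩
               ∑ as (λ a → ι (ν M a ℕ.* fill a s)) * spec s
                 ≈⟨ *-congʳ (ι-∑ as _) ⟨
               ι (Σℕ.∑ as (λ a → ν M a ℕ.* fill a s)) * spec s
                 ≡⟨ ≡.cong (λ k → ι k * spec s) (∑-ν-fillings ≡.refl s) ⟩
               ι (orderings ⊥ s) * spec s ∎) ⟩
        ∑ ss (λ s → ι (orderings ⊥ s) * spec s) ∎
        where
        as = compositions n rank
        ss = sequences n rank

        fill : Composition n rank → Sequence n rank → ℕ
        fill a = fillings (Composition.first a) (Composition.rest a)

      ∑-orderings-spec : ∑ (sequences n rank) (λ s → ι (orderings ⊥ s) * spec s) ≈ ∑ (subsets n) (λ q → F ∣ q ∣ (rk q))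
      ∑-orderings-spec = begin
        ∑ ss (λ s → ι (orderings ⊥ s) * (𝕂.1/ n ! * ∑ ms (λ m → ι (n C m) * F m (ones m s))))
          ≈⟨ ∑-cong ss (λ s → trans (x∙yz≈y∙xz _ _ _) (*-congˡ (trans (sym (∑-*ˡ ms _ _))
               (∑-cong ms λ m → x∙yz≈y∙xz _ _ _)))) ⟩
        ∑ ss (λ s → 𝕂.1/ n ! * ∑ ms (λ m → ι (n C m) * (ι (orderings ⊥ s) * F m (ones m s))))
          ≈⟨ trans (∑-*ˡ ss _ _) (*-congˡ (trans (∑-swap ss ms _) (∑-cong ms λ m → ∑-*ˡ ss _ _))) ⟩
        𝕂.1/ n ! * ∑ ms (λ m → ι (n C m) * ∑ ss (λ s → ι (orderings ⊥ s) * F m (ones m s)))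
          ≈⟨ *-congˡ (∑-cong-∈ ms λ m∈ → by-size (ℕₚ.≤-pred (∈-upTo⁻ m∈))) ⟩
        𝕂.1/ n ! * ∑ ms (λ m → ι (n !) * ∑ (subsets n) (λ q → χ (extensions? ⊥ m q) * F m (rk q)))
          ≈⟨ *-congˡ (∑-*ˡ ms _ _) ⟩
        𝕂.1/ n ! * (ι (n !) * ∑ ms (λ m → ∑ (subsets n) (λ q → χ (extensions? ⊥ m q) * F m (rk q))))
          ≈⟨ trans (sym (*-assoc _ _ _)) (trans (*-congʳ (1/n!*n! n)) (*-identityˡ _)) ⟩
        ∑ ms (λ m → ∑ (subsets n) (λ q → χ (extensions? ⊥ m q) * F m (rk q)))
          ≈⟨ ∑-swap ms (subsets n) _ ⟩
        ∑ (subsets n) (λ q → ∑ ms (λ m → χ (extensions? ⊥ m q) * F m (rk q)))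
          -- Each subset `q` extends the empty set by exactly one number of elements, its size, so
          -- the sum over `m` leaves only that term.
          ≈⟨ ∑-cong (subsets n) (λ q → ∑-χ-unique (λ m → extensions? ⊥ m q) (Uniqueₚ.upTo⁺ (suc n))
               (∈-upTo⁺ (s≤s (∣p∣≤n q)))
               ((λ {x} → ⊥⊆ {p = q} {x}) , ≡.cong (ℕ._+ ∣ q ∣) (≡.sym (∣⊥∣≡0 n)))
               (λ { {m} (_ , eq) → ≡.sym (≡.trans eq (≡.cong (ℕ._+ m) (∣⊥∣≡0 n))) })) ⟩
        ∑ (subsets n) (λ q → F ∣ q ∣ (rk q)) ∎
        where
        ss = sequences n rank
        ms = upTo (suc n)

        by-size : ∀ {m} → m ≤ n → ι (n C m) * ∑ ss (λ s → ι (orderings ⊥ s) * F m (ones m s))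
                    ≈ ι (n !) * ∑ (subsets n) (λ q → χ (extensions? ⊥ m q) * F m (rk q))
        by-size {m} m≤n = trans (*-congˡ (∑-orderings-first (F m) m m≤n)) (trans (sym (*-assoc _ _ _))
          (*-congʳ (trans (sym (ι-* (n C m) _)) (reflexive (≡.cong ι (nCk*k!*[n∸k]!≡n! m≤n))))))

    tutte≈∑-ν-γ̄ : 𝕂.tutte M 𝕂.≈ 𝕂.∑ (compositions n rank) (λ a → ν M a 𝕂.×ₚ 𝕂.γ̄ a)
    tutte≈∑-ν-γ̄ i j = trans
      (φ-∑ i j (subsets n) (λ p → 𝕂.monomial (rank ∸ rk p) (∣ p ∣ ∸ rk p)))
      (sym (trans (∑-ν-γ̄ i j) (∑-orderings-spec i j)))

theorem4p3 : ∀ {c ℓ₁ ℓ₂ : Level}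
    (K : HeytingField c ℓ₁ ℓ₂) (char0 : CharacteristicZero K)
    (n r : ℕ) (M : Matroid n) → Matroid.rank M ≡ r →
    let open Over K char0 in
    (Σ[ coeff ∈ (Composition n r → ℕ) ]
    tutte M ≈ ∑ (compositions n r) (λ a → coeff a ×ₚ γ̄ a))
    × tutte M ≈ ∑ (compositions n r) (λ a → ν M a ×ₚ γ̄ a)
-- The flag counts are natural numbers, so they also witness the existence of non-negative integer
-- coefficients.
theorem4p3 K char0 n r M ≡.refl = (ν M , expansion) , expansion
  where
  expansion = Specialization.tutte≈∑-ν-γ̄ K char0 M
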